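{- There exists a constant $T$ such that the following holds. Let $G=(V,E)$ be a graph without isolated vertices such that for some clustering $\mathcal{C}$ of $G$ into $k$ clusters we have $\mathrm{NCut}(\mathcal{C})\le k-T$. Then one can compute a constant-factor approximate clustering of $G$ with respect to the normalized modularity objective $\mathrm{NMod}$ using a linear-time algorithm (the algorithm and its approximation factor do not depend on $G$).
   Context: A graph $G=(V,E)$ is finite and undirected, with $E$ a set of unordered pairs of distinct vertices; $m=|E|$. $\deg(v)$ is the degree of $v$; for $C\subseteq V$, $\mathrm{vol}(C)=\sum_{v\in C}\deg(v)$; $E(C)$ is the set of edges with both endpoints in $C$, and $E_{out}(C)$ is the set of edges with exactly one endpoint in $C$. A clustering of $G$ is a partition of $V$ into disjoint nonempty subsets (clusters) whose union is $V$. For a clustering $\mathcal{C}=\{C_1,\dots,C_k\}$, the normalized cut is $\mathrm{NCut}(\mathcal{C})=\sum_{i=1}^k\frac{|E_{out}(C_i)|}{\mathrm{vol}(C_i)}$. The modularity of $C\subseteq V$ is $M(C)=\frac1m\left(|E(C)|-\frac{\mathrm{vol}(C)^2}{4m}\right)$, and the normalized modularity of $\mathcal{C}$ is $\mathrm{NMod}(\mathcal{C})=\sum_{i=1}^k\frac{M(C_i)}{\mathrm{vol}(C_i)}$. For a quality function $f$ on clusterings and $\alpha\in(0,1]$, a clustering $\mathcal{C}$ is $\alpha$-approximate if $f(\mathcal{C})\ge\alpha\cdot f(\mathcal{C}')$ for every clustering $\mathcal{C}'$; it is constant-factor approximate if it is $\alpha$-approximate for an absolute constant $\alpha\in(0,1]$.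 Linear time means time $O(|V|+|E|)$. -}

module Defs where

open import Data.Bool using (if_then_else_)
open import Data.Fin as Fin using (Fin; toℕ)
open import Data.Fin.Subset using (Subset; _∈_; _∉_; _∩_; Nonempty; Empty)
open import Data.Fin.Subset.Properties using (_∈?_)
open import Data.Integer using (+_)
open import Data.List using (List; []; _∷_; length; map; filter; allFin)
open import Data.List.Relation.Unary.All using (All)
open import Data.List.Relation.Unary.Unique.Propositional using (Unique)
open import Data.Nat as ℕ using (ℕ; zero; suc; _≡ᵇ_)
open import Data.Nat.ListAction as ListAction using ()
open import Data.Product using (_×_; _,_; proj₁; proj₂; ∃)
open import Data.Rational as ℚ using (ℚ; 0ℚ; _/_)
open import Data.Rational.Properties using (+-0-commutativeMonoid)
open import Data.Sum using (_⊎_)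
open import Function using (_∘_; _⇔_)
open import Relation.Binary.PropositionalEquality using (_≡_; _≢_)
open import Relation.Nullary using (Dec; ¬?)
open import Relation.Nullary.Decidable using (_×-dec_; _⊎-dec_)
open import Algebra.Bundles using (CommutativeMonoid)
open import Algebra.Properties.Monoid.Sum (CommutativeMonoid.monoid +-0-commutativeMonoid) using (sum)

-- The unordered pair {u , v} of distinct vertices is stored as (u , v) with
-- u < v, so a list without repetitions is a set of such pairs.  The list order
-- matters only as the order in which an algorithm is given the edges.
record Graph : Set where
  field
    order   : ℕ
    edges   : List (Fin order × Fin order)
    ordered : All (λ e → proj₁ e Fin.< proj₂ e) edges
    unique  : Unique edges

  Vertex : Set
  Vertex = Fin order

  ∣E∣ : ℕ
  ∣E∣ = length edges

  deg : Vertex → ℕ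
  deg v = length (filter (λ e → (proj₁ e Fin.≟ v) ⊎-dec (proj₂ e Fin.≟ v)) edges)

  vol : Subset order → ℕ
  vol C = ListAction.sum (map deg (filter (_∈? C) (allFin order)))

  E : Subset order → List (Vertex × Vertex)
  E C = filter (λ e → (proj₁ e ∈? C) ×-dec (proj₂ e ∈? C)) edges

  ExactlyOneIn : Subset order → Vertex × Vertex → Set
  ExactlyOneIn C (u , v) = (u ∈ C × v ∉ C) ⊎ (u ∉ C × v ∈ C)

  exactlyOneIn? : ∀ C e → Dec (ExactlyOneIn C e)
  exactlyOneIn? C (u , v) =
    ((u ∈? C) ×-dec ¬? (v ∈? C)) ⊎-dec (¬? (u ∈? C) ×-dec (v ∈? C))

  E-out : Subset order → List (Vertex × Vertex)
  E-out C = filter (exactlyOneIn? C) edges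

  NoIsolatedVertices : Set
  NoIsolatedVertices = ∀ v → 0 ℕ.< deg v

record Clustering (n : ℕ) : Set where
  field
    k        : ℕ
    cluster  : Fin k → Subset n
    nonempty : ∀ i → Nonempty (cluster i)
    disjoint : ∀ i j → i ≢ j → Empty (cluster i ∩ cluster j)
    covering : ∀ v → ∃ λ i → v ∈ cluster i

fromℕ : ℕ → ℚ
fromℕ n = + n / 1

-- Division by 0 is given the value 0.  In a graph without isolated vertices
-- every nonempty C has vol C > 0 (and then m > 0), so this convention never
-- affects NCut or NMod of a clustering of such a graph.
infixl 7 _÷ℕ_
_÷ℕ_ : ℚ → ℕ → ℚ
p ÷ℕ zero      = 0ℚ
p ÷ℕ d@(suc _) = p ℚ.* (+ 1 / d)

module _ (G : Graph) where
  open Graph G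

  NCut : Clustering order → ℚ
  NCut 𝓒 = sum λ i → fromℕ (length (E-out (cluster i))) ÷ℕ vol (cluster i)
    where open Clustering 𝓒

  modularity : Subset order → ℚ
  modularity C =
    (fromℕ (length (E C)) ℚ.- fromℕ (vol C ℕ.* vol C) ÷ℕ (4 ℕ.* ∣E∣)) ÷ℕ ∣E∣

  NMod : Clustering order → ℚ
  NMod 𝓒 = sum λ i → modularity (cluster i) ÷ℕ vol (cluster i)
    where open Clustering 𝓒

Approximate : ∀ {n} → (Clustering n → ℚ) → ℚ → Clustering n → Set
Approximate f α 𝓒 = ∀ 𝓒′ → f 𝓒 ℚ.≥ α ℚ.* f 𝓒′

-- Algorithms are structured programs for a unit-cost word RAM.  A program is a
-- finite piece of syntax, so it uses a fixed finite number of
-- registers and of arrays (named by numerals), whatever the input.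
data Op : Set where
  add sub mul div : Op

data Expr : Set where
  lit  : ℕ → Expr
  reg  : ℕ → Expr
  read : ℕ → Expr → Expr
  op   : Op → Expr → Expr → Expr

infixr 5 _⨾_
data Program : Set where
  skip  : Program
  set   : ℕ → Expr → Program
  write : ℕ → Expr → Expr → Program
  _⨾_   : Program → Program → Program
  ifnz  : Expr → Program → Program → Program
  while : Expr → Program → Program

apply : Op → ℕ → ℕ → ℕ
apply add a b       = a ℕ.+ b
apply sub a b       = a ℕ.∸ b
apply mul a b       = a ℕ.* b
apply div a zero    = 0
apply div a (suc b) = a ℕ./ suc b

record State : Set where
  constructor state
  field
    regs   : ℕ → ℕ
    arrays : ℕ → ℕ → ℕ

open State public

update : {A : Set} → (ℕ → A) → ℕ → A → ℕ → A
update f x a y = if y ≡ᵇ x then a else f y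

setReg : State → ℕ → ℕ → State
setReg s x v = state (update (regs s) x v) (arrays s)

writeArray : State → ℕ → ℕ → ℕ → State
writeArray s a i v =
  state (regs s) (update (arrays s) a (update (arrays s a) i v))

-- Every literal, register access, array access and arithmetic operation costs
-- one step.
cost : Expr → ℕ
cost (lit _)     = 1
cost (reg _)     = 1
cost (read _ e)  = suc (cost e)
cost (op _ e e′) = suc (cost e ℕ.+ cost e′)

-- Evaluation on a machine whose words hold the numbers below W; a result
-- that does not fit into a word has no value, so the program is stuck.
infix 4 _⊢_,_↓_
data _⊢_,_↓_ (W : ℕ) : Expr → State → ℕ → Set where
  lit  : ∀ {n s} → n ℕ.< W → W ⊢ lit n , s ↓ n
  reg  : ∀ {x s} → W ⊢ reg x , s ↓ regs s x
  read : ∀ {a e s i} → W ⊢ e , s ↓ i → W ⊢ read a e , s ↓ arrays s a i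
  op   : ∀ {o e e′ s a b} → W ⊢ e , s ↓ a → W ⊢ e′ , s ↓ b →
         apply o a b ℕ.< W → W ⊢ op o e e′ , s ↓ apply o a b

-- W ⊢ P , s ⇓ s′ ⟨ t ⟩: started in s, P halts in s′ after t steps.
infix 4 _⊢_,_⇓_⟨_⟩
data _⊢_,_⇓_⟨_⟩ (W : ℕ) : Program → State → State → ℕ → Set where
  skip  : ∀ {s} → W ⊢ skip , s ⇓ s ⟨ 1 ⟩
  set   : ∀ {x e s v} → W ⊢ e , s ↓ v →
          W ⊢ set x e , s ⇓ setReg s x v ⟨ suc (cost e) ⟩
  write : ∀ {a e e′ s i v} → W ⊢ e , s ↓ i → W ⊢ e′ , s ↓ v →
          W ⊢ write a e e′ , s ⇓ writeArray s a i v ⟨ suc (cost e ℕ.+ cost e′) ⟩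
  _⨾_   : ∀ {P Q s s′ s″ t t′} →
          W ⊢ P , s ⇓ s′ ⟨ t ⟩ → W ⊢ Q , s′ ⇓ s″ ⟨ t′ ⟩ →
          W ⊢ P ⨾ Q , s ⇓ s″ ⟨ t ℕ.+ t′ ⟩
  if-nonzero : ∀ {e P Q s s′ v t} → W ⊢ e , s ↓ suc v → W ⊢ P , s ⇓ s′ ⟨ t ⟩ →
          W ⊢ ifnz e P Q , s ⇓ s′ ⟨ suc (cost e ℕ.+ t) ⟩
  if-zero : ∀ {e P Q s s′ t} → W ⊢ e , s ↓ 0 → W ⊢ Q , s ⇓ s′ ⟨ t ⟩ →
          W ⊢ ifnz e P Q , s ⇓ s′ ⟨ suc (cost e ℕ.+ t) ⟩
  while-nonzero : ∀ {e P s s′ s″ v t t′} → W ⊢ e , s ↓ suc v →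
          W ⊢ P , s ⇓ s′ ⟨ t ⟩ → W ⊢ while e P , s′ ⇓ s″ ⟨ t′ ⟩ →
          W ⊢ while e P , s ⇓ s″ ⟨ suc (cost e ℕ.+ t ℕ.+ t′) ⟩
  while-zero : ∀ {e P s} → W ⊢ e , s ↓ 0 →
          W ⊢ while e P , s ⇓ s ⟨ suc (cost e) ⟩

fromList : List ℕ → ℕ → ℕ
fromList []       _       = 0
fromList (x ∷ xs) zero    = x
fromList (x ∷ xs) (suc i) = fromList xs i

-- Input: |V| in register 0, |E| in register 1, the endpoints of the i-th edge
-- in cell i of arrays 0 and 1; everything else is zero.
input : Graph → State
input G = state r a
  where
  open Graph G
  r : ℕ → ℕ
  r 0 = order
  r 1 = ∣E∣
  r _ = 0
  a : ℕ → ℕ → ℕ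
  a 0   = fromList (map (toℕ ∘ proj₁) edges)
  a 1   = fromList (map (toℕ ∘ proj₂) edges)
  a _ _ = 0

-- Output: array 2 holds a label for each vertex, and two vertices get the same
-- label precisely when they are in the same cluster.
Outputs : ∀ {n} → State → Clustering n → Set
Outputs s 𝓒 = ∀ u v →
  (arrays s 2 (toℕ u) ≡ arrays s 2 (toℕ v)) ⇔ (∃ λ i → u ∈ cluster i × v ∈ cluster i)
  where open Clustering 𝓒

-- Words of κ · log₂ (2 + |V| + |E|) bits.
wordBound : ℕ → Graph → ℕ
wordBound κ G = (2 ℕ.+ order ℕ.+ ∣E∣) ℕ.^ κ
  where open Graph G

Computes : Program → ℕ → (G : Graph) → Clustering (Graph.order G) → ℕ → Set
Computes P κ G 𝓒 t = ∃ λ s → (wordBound κ G ⊢ P , input G ⇓ s ⟨ t ⟩) × Outputs s 𝓒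

-- P computes, on every graph satisfying Promise, a clustering satisfying Good.
-- The word-size and running-time constants κ and c do not depend on the graph.
LinearTime : Program → (Promise : Graph → Set) →
             (Good : (G : Graph) → Clustering (Graph.order G) → Set) → Set
LinearTime P Promise Good =
  ∃ λ κ → ∃ λ c → ∀ G → Promise G →
  ∃ λ 𝓒 → ∃ λ t → Computes P κ G 𝓒 t × t ℕ.≤ c ℕ.* (Graph.order G ℕ.+ Graph.∣E∣ G) × Good G 𝓒

{-# OPTIONS --safe #-}

-- Let e(C) = |E(C)| / vol(C).  For every clustering NCut = k − 2 Σ e(Cᵢ) and
-- NMod = (Σ e(Cᵢ) − ½) / m, so the promise says that some clustering has a
-- large Σ e(Cᵢ), and it suffices to maximise Σ e(Cᵢ) up to a constant factor.
--
-- The algorithm packs stars greedily.  It treats the edges {u , v}, where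
-- deg u ≤ deg v, in ascending order of deg u + deg v, and makes u a leaf of v
-- if u is still in no star, v is no leaf and the leaves of v have total degree
-- below deg v.  A leaf added to v pays 1 / deg v to itself and to v; let y w be
-- what w has received.  In the end every edge satisfies
--   1 ≤ deg v · y u + deg u · y v,
-- because whatever prevented u from joining v has been paid for by edges with
-- a smaller or equal key.  Summing over the edges inside C gives
-- |E(C)| ≤ vol(C) · Σ_{w ∈ C} y w, hence Σ e(Cᵢ) ≤ Σ_w y w for every clustering.
-- Conversely a star with centre v and j leaves has volume at most 3 deg v and
-- has received 2 j / deg v, which is at most six times its e.
module Submission where

open import Defs
open import Algebra.Bundles using (CommutativeMonoid)
open import Data.Bool using (true; false; T; if_then_else_)
open import Data.Empty using (⊥-elim)
open import Data.Fin as Fin using (Fin; toℕ; fromℕ<)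
import Data.Fin.Properties as Fin
open import Data.Fin.Subset using (Subset; _∈_)
open import Data.Fin.Subset.Properties using (_∈?_; x∈p∩q⁺; x∈p∩q⁻)
import Data.Integer as ℤ
import Data.Integer.Properties as ℤ
open import Data.List as List using (List; []; _∷_; length; map; filter; take; allFin; tabulate; deduplicate)
import Data.List.Properties as List
open import Data.List.Membership.Propositional using () renaming (_∈_ to _∈ₗ_)
open import Data.List.Membership.Propositional.Properties using (∈-allFin; ∈-lookup; ∈-map⁺; ∈-map⁻; ∈-deduplicate⁺; ∈-deduplicate⁻)
open import Data.List.Relation.Unary.All as All using (All; []; _∷_)
open import Data.List.Relation.Unary.AllPairs using ([]; _∷_)
open import Data.List.Relation.Unary.Any as Any using (here; there)
open import Data.List.Relation.Unary.Any.Properties using (lookup-index)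
open import Data.List.Relation.Unary.Unique.DecPropositional.Properties using (deduplicate-!)
open import Data.List.Relation.Unary.Unique.Propositional using (Unique)
open import Data.List.Relation.Unary.Unique.Propositional.Properties using (allFin⁺)
open import Data.Nat as ℕ using (ℕ; zero; suc; z≤n; s≤s; _≡ᵇ_)
open import Data.Nat.ListAction as ListAction using ()
import Data.Nat.Properties as ℕ
import Data.Nat.Solver as ℕ
open import Data.Product using (_×_; _,_; proj₁; proj₂; ∃)
open import Data.Product.Properties using (≡-dec)
open import Data.Rational using (ℚ; 0ℚ; 1ℚ; ½; _<_; _≤_; _-_; _+_; _*_; -_; _/_; toℚᵘ; nonNegative)
import Data.Rational as ℚ
open import Data.Rational.Properties as ℚ using (≤-refl; ≤-trans; ≤-reflexive)
open import Data.Rational.Solver using (module +-*-Solver)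
import Data.Rational.Unnormalised as ℚᵘ
import Data.Rational.Unnormalised.Properties as ℚᵘ
open import Data.Sum using (_⊎_; inj₁; inj₂)
open import Data.Unit using (tt)
import Data.Vec as Vec
open import Data.Vec.Functional using (updateAt)
open import Data.Vec.Functional.Properties using (updateAt-updates; updateAt-minimal)
open import Data.Vec.Properties using ([]=⇒lookup; lookup⇒[]=; lookup∘tabulate)
open import Function using (_∘_; id; const; mk⇔; _⇔_; Equivalence)
open import Relation.Binary.PropositionalEquality using (_≡_; _≢_; refl; sym; trans; cong; cong₂; subst; subst₂; module ≡-Reasoning)
open import Relation.Nullary using (Dec; yes; no; does; ¬_)
open import Relation.Nullary.Decidable using (_×-dec_; _⊎-dec_; dec-true; dec-false; toWitness; toWitnessFalse)
open import Relation.Unary using (Decidable; Pred)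
import Algebra.Properties.Monoid.Sum (CommutativeMonoid.monoid ℚ.+-0-commutativeMonoid) as FinSum

open +-*-Solver
open ℕ.+-*-Solver using () renaming (solve to solveℕ; _:+_ to _+′_; _:*_ to _×′_; _:=_ to _=′_; con to con′)

-- Rational sums

-- Why the ascending order pays for every edge: let K = deg u + deg v be the current key. A full
-- centre v took its leaves at keys at most K, so each has degree at most deg u, there are at least
-- deg v / deg u of them, and v has received at least 1 / deg u. If u is already a leaf of x, its
-- key gives deg x ≤ deg v, so u has received at least 1 / deg v; likewise with u and v exchanged.
-- If u is a centre, its first leaf alone brought 1 / deg u ≥ 1 / deg v. The cases of full centres
-- and of leaves are one inequality, the `budget` of `Local`, because a leaf carries its own degree
-- as load.
--
-- Approximating Σ e(Cᵢ) does not by itself approximate NMod, since the subtracted ½ could consume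
-- everything. The threshold prevents this: with T = 12 the promised clustering has Σ e ≥ 6, so the
-- stars, which lose at most a factor 6, have Σ e ≥ 1, and the ½ costs at most another factor 2.
-- Hence the ratio 1/12.
--
-- Keys are at most 2m, so the sorting is a distribution into 2m + 1 buckets and stays linear.

toℚᵘ-fromℕ : ∀ n → toℚᵘ (fromℕ n) ℚᵘ.≃ ℚᵘ.mkℚᵘ (ℤ.+ n) 0
toℚᵘ-fromℕ n = ℚ.toℚᵘ-fromℚᵘ (ℚᵘ.mkℚᵘ (ℤ.+ n) 0)

fromℕ-+ : ∀ m n → fromℕ (m ℕ.+ n) ≡ fromℕ m + fromℕ n
fromℕ-+ m n = ℚ.toℚᵘ-injective (begin
  toℚᵘ (fromℕ (m ℕ.+ n))                          ≈⟨ toℚᵘ-fromℕ (m ℕ.+ n) ⟩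
  ℚᵘ.mkℚᵘ (ℤ.+ (m ℕ.+ n)) 0                       ≈⟨ ℚᵘ.*≡* (cong (ℤ._* ℤ.1ℤ) (sym (cong₂ ℤ._+_ (ℤ.*-identityʳ (ℤ.+ m)) (ℤ.*-identityʳ (ℤ.+ n))))) ⟩
  ℚᵘ.mkℚᵘ (ℤ.+ m) 0 ℚᵘ.+ ℚᵘ.mkℚᵘ (ℤ.+ n) 0        ≈⟨ ℚᵘ.+-cong (toℚᵘ-fromℕ m) (toℚᵘ-fromℕ n) ⟨
  toℚᵘ (fromℕ m) ℚᵘ.+ toℚᵘ (fromℕ n)              ≈⟨ ℚ.toℚᵘ-homo-+ (fromℕ m) (fromℕ n) ⟨
  toℚᵘ (fromℕ m + fromℕ n)                        ∎)
  where open ℚᵘ.≃-Reasoning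

fromℕ-* : ∀ m n → fromℕ (m ℕ.* n) ≡ fromℕ m * fromℕ n
fromℕ-* m n = ℚ.toℚᵘ-injective (begin
  toℚᵘ (fromℕ (m ℕ.* n))                          ≈⟨ toℚᵘ-fromℕ (m ℕ.* n) ⟩
  ℚᵘ.mkℚᵘ (ℤ.+ (m ℕ.* n)) 0                       ≈⟨ ℚᵘ.*≡* (cong (ℤ._* ℤ.1ℤ) (ℤ.pos-* m n)) ⟩
  ℚᵘ.mkℚᵘ (ℤ.+ m) 0 ℚᵘ.* ℚᵘ.mkℚᵘ (ℤ.+ n) 0        ≈⟨ ℚᵘ.*-cong (toℚᵘ-fromℕ m) (toℚᵘ-fromℕ n) ⟨
  toℚᵘ (fromℕ m) ℚᵘ.* toℚᵘ (fromℕ n)              ≈⟨ ℚ.toℚᵘ-homo-* (fromℕ m) (fromℕ n) ⟨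
  toℚᵘ (fromℕ m * fromℕ n)                        ∎)
  where open ℚᵘ.≃-Reasoning

0≤fromℕ : ∀ n → 0ℚ ≤ fromℕ n
0≤fromℕ n = ℚ.nonNegative⁻¹ (fromℕ n) {{ℚ.normalize-nonNeg n 1}}

fromℕ-mono : ∀ {m n} → m ℕ.≤ n → fromℕ m ≤ fromℕ n
fromℕ-mono {m} {n} m≤n = begin
  fromℕ m                       ≡⟨ ℚ.+-identityʳ _ ⟨
  fromℕ m + 0ℚ                  ≤⟨ ℚ.+-monoʳ-≤ (fromℕ m) (0≤fromℕ (n ℕ.∸ m)) ⟩
  fromℕ m + fromℕ (n ℕ.∸ m)     ≡⟨ fromℕ-+ m (n ℕ.∸ m) ⟨
  fromℕ (m ℕ.+ (n ℕ.∸ m))       ≡⟨ cong fromℕ (ℕ.m+[n∸m]≡n m≤n) ⟩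
  fromℕ n                       ∎
  where open ℚ.≤-Reasoning

0≤+ : ∀ {p q} → 0ℚ ≤ p → 0ℚ ≤ q → 0ℚ ≤ p + q
0≤+ = ℚ.+-mono-≤

0≤* : ∀ {p q} → 0ℚ ≤ p → 0ℚ ≤ q → 0ℚ ≤ p * q
0≤* {p} {q} 0≤p 0≤q = ≤-trans (≤-reflexive (sym (ℚ.*-zeroʳ p))) (ℚ.*-monoˡ-≤-nonNeg p {{nonNegative 0≤p}} 0≤q)

*-monoˡ : ∀ {r p q} → 0ℚ ≤ r → p ≤ q → r * p ≤ r * q
*-monoˡ {r} 0≤r = ℚ.*-monoˡ-≤-nonNeg r {{nonNegative 0≤r}}

*-monoʳ : ∀ {r p q} → 0ℚ ≤ r → p ≤ q → p * r ≤ q * r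
*-monoʳ {r} 0≤r = ℚ.*-monoʳ-≤-nonNeg r {{nonNegative 0≤r}}

recip : ℕ → ℚ
recip n = 1ℚ ÷ℕ n

-- The convention of `÷ℕ` makes `recip 0` zero, so every division becomes a multiplication without a
-- positivity hypothesis and is accessible to the ring solver.
÷ℕ-recip : ∀ p n → p ÷ℕ n ≡ p * recip n
÷ℕ-recip p zero    = sym (ℚ.*-zeroʳ p)
÷ℕ-recip p (suc n) = cong (p *_) (sym (ℚ.*-identityˡ _))

recip-inverse : ∀ {n} → 0 ℕ.< n → fromℕ n * recip n ≡ 1ℚ
recip-inverse {suc n} _ = trans (cong (fromℕ (suc n) *_) (ℚ.*-identityˡ _)) (ℚ.toℚᵘ-injective (begin
  toℚᵘ (fromℕ (suc n) * (ℤ.+ 1 / suc n))                ≈⟨ ℚ.toℚᵘ-homo-* (fromℕ (suc n)) (ℤ.+ 1 / suc n) ⟩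
  toℚᵘ (fromℕ (suc n)) ℚᵘ.* toℚᵘ (ℤ.+ 1 / suc n)        ≈⟨ ℚᵘ.*-cong (toℚᵘ-fromℕ (suc n)) (ℚ.toℚᵘ-fromℚᵘ (ℚᵘ.mkℚᵘ (ℤ.+ 1) n)) ⟩
  ℚᵘ.mkℚᵘ (ℤ.+ suc n) 0 ℚᵘ.* ℚᵘ.mkℚᵘ (ℤ.+ 1) n          ≈⟨ ℚᵘ.*≡* (cong (λ k → ℤ.+ suc k) (trans (trans (ℕ.*-identityʳ (n ℕ.* 1)) (ℕ.*-identityʳ n)) (sym (trans (ℕ.+-identityʳ (n ℕ.+ 0)) (ℕ.+-identityʳ n))))) ⟩
  toℚᵘ 1ℚ                                               ∎))
  where open ℚᵘ.≃-Reasoning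

0≤recip : ∀ n → 0ℚ ≤ recip n
0≤recip zero    = ≤-refl
0≤recip (suc n) = 0≤* (0≤fromℕ 1) (ℚ.nonNegative⁻¹ (ℤ.+ 1 / suc n) {{ℚ.normalize-nonNeg 1 (suc n)}})

-- The Iverson bracket. Cardinalities of filtered lists become sums of it, so that double counting
-- is an exchange of sums.
𝟙 : ∀ {p} {P : Set p} → Dec P → ℚ
𝟙 d = if does d then 1ℚ else 0ℚ

module _ {p} {P : Set p} where

  𝟙-yes : (P? : Dec P) → P → 𝟙 P? ≡ 1ℚ
  𝟙-yes P? h = cong (if_then 1ℚ else 0ℚ) (dec-true P? h)

  𝟙-no : (P? : Dec P) → ¬ P → 𝟙 P? ≡ 0ℚ
  𝟙-no P? h = cong (if_then 1ℚ else 0ℚ) (dec-false P? h)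

  0≤𝟙 : (P? : Dec P) → 0ℚ ≤ 𝟙 P?
  0≤𝟙 (yes _) = 0≤fromℕ 1
  0≤𝟙 (no _)  = ≤-refl

module _ {p q} {P : Set p} {Q : Set q} where

  𝟙-⇔ : (P? : Dec P) (Q? : Dec Q) → (P → Q) → (Q → P) → 𝟙 P? ≡ 𝟙 Q?
  𝟙-⇔ (yes h) Q? f g = sym (𝟙-yes Q? (f h))
  𝟙-⇔ (no h)  Q? f g = sym (𝟙-no Q? (h ∘ g))

  𝟙-× : (P? : Dec P) (Q? : Dec Q) → 𝟙 (P? ×-dec Q?) ≡ 𝟙 P? * 𝟙 Q?
  𝟙-× (yes _) (yes _) = refl
  𝟙-× (yes _) (no _)  = refl
  𝟙-× (no _)  (yes _) = refl
  𝟙-× (no _)  (no _)  = refl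

  𝟙-⊎ : (P? : Dec P) (Q? : Dec Q) → ¬ (P × Q) → 𝟙 (P? ⊎-dec Q?) ≡ 𝟙 P? + 𝟙 Q?
  𝟙-⊎ (yes a) (yes b) h = ⊥-elim (h (a , b))
  𝟙-⊎ (yes _) (no _)  h = refl
  𝟙-⊎ (no _)  (yes _) h = refl
  𝟙-⊎ (no _)  (no _)  h = refl

∑ : ∀ {A : Set} → List A → (A → ℚ) → ℚ
∑ []       f = 0ℚ
∑ (x ∷ xs) f = f x + ∑ xs f

syntax ∑ xs (λ x → e) = ∑[ x ← xs ] e
infix 5 ∑

module _ {A : Set} where

  ∑-cong : ∀ (xs : List A) {f g} → (∀ x → x ∈ₗ xs → f x ≡ g x) → ∑ xs f ≡ ∑ xs g
  ∑-cong []       h = refl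
  ∑-cong (x ∷ xs) h = cong₂ _+_ (h x (here refl)) (∑-cong xs (λ y → h y ∘ there))

  ∑-mono : ∀ (xs : List A) {f g} → (∀ x → x ∈ₗ xs → f x ≤ g x) → ∑ xs f ≤ ∑ xs g
  ∑-mono []       h = ≤-refl
  ∑-mono (x ∷ xs) h = ℚ.+-mono-≤ (h x (here refl)) (∑-mono xs (λ y → h y ∘ there))

  ∑-zero : ∀ (xs : List A) → (∑[ x ← xs ] 0ℚ) ≡ 0ℚ
  ∑-zero []       = refl
  ∑-zero (x ∷ xs) = trans (ℚ.+-identityˡ _) (∑-zero xs)

  ∑-nonNeg : ∀ (xs : List A) {f} → (∀ x → 0ℚ ≤ f x) → 0ℚ ≤ ∑ xs f
  ∑-nonNeg xs {f} h = ≤-trans (≤-reflexive (sym (∑-zero xs))) (∑-mono xs (λ x _ → h x))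

  ∑-+ : ∀ (xs : List A) f g → (∑[ x ← xs ] (f x + g x)) ≡ ∑ xs f + ∑ xs g
  ∑-+ []       f g = refl
  ∑-+ (x ∷ xs) f g = trans (cong (f x + g x +_) (∑-+ xs f g))
    (solve 4 (λ a b c d → a :+ b :+ (c :+ d) := a :+ c :+ (b :+ d)) refl (f x) (g x) (∑ xs f) (∑ xs g))

  ∑-*ʳ : ∀ (xs : List A) f c → (∑[ x ← xs ] (f x * c)) ≡ ∑ xs f * c
  ∑-*ʳ []       f c = sym (ℚ.*-zeroˡ c)
  ∑-*ʳ (x ∷ xs) f c = trans (cong (f x * c +_) (∑-*ʳ xs f c)) (sym (ℚ.*-distribʳ-+ c (f x) (∑ xs f)))

  ∑-*ˡ : ∀ (xs : List A) c f → (∑[ x ← xs ] (c * f x)) ≡ c * ∑ xs f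
  ∑-*ˡ xs c f = trans (∑-cong xs (λ x _ → ℚ.*-comm c (f x))) (trans (∑-*ʳ xs f c) (ℚ.*-comm _ c))

  ∑-one : ∀ (xs : List A) → (∑[ x ← xs ] 1ℚ) ≡ fromℕ (length xs)
  ∑-one []       = refl
  ∑-one (x ∷ xs) = trans (cong (1ℚ +_) (∑-one xs)) (sym (fromℕ-+ 1 (length xs)))

  ∑-filter : ∀ {p} {P : Pred A p} (P? : Decidable P) f xs →
             ∑ (filter P? xs) f ≡ (∑[ x ← xs ] (𝟙 (P? x) * f x))
  ∑-filter P? f []       = refl
  ∑-filter P? f (x ∷ xs) with does (P? x)
  ... | true  = cong₂ _+_ (sym (ℚ.*-identityˡ (f x))) (∑-filter P? f xs)
  ... | false = trans (∑-filter P? f xs) (sym (trans (cong (_+ _) (ℚ.*-zeroˡ (f x))) (ℚ.+-identityˡ _)))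

  length-filter≡∑ : ∀ {p} {P : Pred A p} (P? : Decidable P) xs →
                    fromℕ (length (filter P? xs)) ≡ (∑[ x ← xs ] 𝟙 (P? x))
  length-filter≡∑ P? xs = trans (sym (∑-one (filter P? xs)))
    (trans (∑-filter P? (λ _ → 1ℚ) xs) (∑-cong xs (λ _ _ → ℚ.*-identityʳ _)))

  fromℕ-sum : ∀ (g : A → ℕ) xs → fromℕ (ListAction.sum (map g xs)) ≡ ∑ xs (fromℕ ∘ g)
  fromℕ-sum g []       = refl
  fromℕ-sum g (x ∷ xs) = trans (fromℕ-+ (g x) _) (cong (fromℕ (g x) +_) (fromℕ-sum g xs))

  module _ (_≟_ : ∀ (x y : A) → Dec (x ≡ y)) where

    ∑-δ-∉ : ∀ xs a → All (a ≢_) xs → (∑[ x ← xs ] 𝟙 (x ≟ a)) ≡ 0ℚ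
    ∑-δ-∉ xs a a∉ = trans (∑-cong xs (λ x x∈ → 𝟙-no (x ≟ a) (All.lookup a∉ x∈ ∘ sym))) (∑-zero xs)

    ∑-δ : ∀ {xs} a → Unique xs → a ∈ₗ xs → (∑[ x ← xs ] 𝟙 (x ≟ a)) ≡ 1ℚ
    ∑-δ {x ∷ xs} a (a∉ ∷ _) (here refl) = trans (cong₂ _+_ (𝟙-yes (x ≟ a) refl) (∑-δ-∉ xs a a∉)) refl
    ∑-δ {x ∷ xs} a (x∉ ∷ u) (there a∈)  =
      trans (cong₂ _+_ (𝟙-no (x ≟ a) (λ x≡a → All.lookup x∉ a∈ x≡a)) (∑-δ a u a∈)) refl

    ∑-δ≤1 : ∀ {xs} a → Unique xs → (∑[ x ← xs ] 𝟙 (x ≟ a)) ≤ 1ℚ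
    ∑-δ≤1 {[]}     a u = 0≤fromℕ 1
    ∑-δ≤1 {x ∷ xs} a (x∉ ∷ u) with x ≟ a
    ... | yes refl = ≤-reflexive (trans (cong (1ℚ +_) (∑-δ-∉ xs a x∉)) refl)
    ... | no  _    = ≤-trans (≤-reflexive (ℚ.+-identityˡ _)) (∑-δ≤1 a u)

∑-tabulate : ∀ {A : Set} {k} (g : Fin k → A) f → ∑ (tabulate g) f ≡ FinSum.sum (f ∘ g)
∑-tabulate {k = zero}  g f = refl
∑-tabulate {k = suc k} g f = cong (f (g Fin.zero) +_) (∑-tabulate (g ∘ Fin.suc) f)

∑-swap : ∀ {A B : Set} (xs : List A) (ys : List B) (f : A → B → ℚ) →
         (∑[ x ← xs ] ∑[ y ← ys ] f x y) ≡ (∑[ y ← ys ] ∑[ x ← xs ] f x y)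
∑-swap []       ys f = sym (∑-zero ys)
∑-swap (x ∷ xs) ys f = trans (cong (∑ ys (f x) +_) (∑-swap xs ys f)) (sym (∑-+ ys (f x) _))

∑-∈ : ∀ {A : Set} {xs : List A} {f} {a} → (∀ x → 0ℚ ≤ f x) → a ∈ₗ xs → f a ≤ ∑ xs f
∑-∈ {xs = x ∷ xs} {f} 0≤f (here refl) = ≤-trans (≤-reflexive (sym (ℚ.+-identityʳ (f x)))) (ℚ.+-monoʳ-≤ (f x) (∑-nonNeg xs 0≤f))
∑-∈ {xs = x ∷ xs} {f} 0≤f (there a∈)  = ≤-trans (≤-reflexive (sym (ℚ.+-identityˡ _))) (ℚ.+-mono-≤ (0≤f x) (∑-∈ {f = f} 0≤f a∈))

∑-allFin : ∀ {k} (f : Fin k → ℚ) → ∑ (allFin k) f ≡ FinSum.sum f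
∑-allFin = ∑-tabulate id

∑-sift : ∀ {n} (f : Fin n → ℚ) a → (∑[ v ← allFin n ] (f v * 𝟙 (a Fin.≟ v))) ≡ f a
∑-sift {n} f a = begin
  (∑[ v ← allFin n ] (f v * 𝟙 (a Fin.≟ v)))  ≡⟨ ∑-cong (allFin n) (λ v _ → move v) ⟩
  (∑[ v ← allFin n ] (f a * 𝟙 (v Fin.≟ a)))  ≡⟨ ∑-*ˡ (allFin n) (f a) _ ⟩
  f a * (∑[ v ← allFin n ] 𝟙 (v Fin.≟ a))    ≡⟨ cong (f a *_) (∑-δ Fin._≟_ a (allFin⁺ n) (∈-allFin a)) ⟩
  f a * 1ℚ                                   ≡⟨ ℚ.*-identityʳ (f a) ⟩
  f a                                        ∎
  where
  open ≡-Reasoning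
  move : ∀ v → f v * 𝟙 (a Fin.≟ v) ≡ f a * 𝟙 (v Fin.≟ a)
  move v with a Fin.≟ v
  ... | yes refl = cong (f a *_) (sym (𝟙-yes (a Fin.≟ a) refl))
  ... | no a≢v   = trans (ℚ.*-zeroʳ (f v)) (sym (trans (cong (f a *_) (𝟙-no (v Fin.≟ a) (a≢v ∘ sym))) (ℚ.*-zeroʳ (f a))))

-- Used from right to left, it spreads the value at one pair over all pairs, so that a sum over
-- edges can be exchanged with sums over pairs.
∑-sift₂ : ∀ {n} (h : Fin n → Fin n → ℚ) a b →
          (∑[ u ← allFin n ] ∑[ v ← allFin n ] (h u v * (𝟙 (a Fin.≟ u) * 𝟙 (b Fin.≟ v)))) ≡ h a b
∑-sift₂ {n} h a b = trans (∑-cong (allFin n) (λ u _ → inner u)) (∑-sift (λ u → h u b) a)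
  where
  inner : ∀ u → (∑[ v ← allFin n ] (h u v * (𝟙 (a Fin.≟ u) * 𝟙 (b Fin.≟ v)))) ≡ h u b * 𝟙 (a Fin.≟ u)
  inner u = trans (∑-cong (allFin n) (λ v _ → solve 3 (λ x y z → x :* (y :* z) := x :* z :* y) refl (h u v) (𝟙 (a Fin.≟ u)) (𝟙 (b Fin.≟ v))))
    (trans (∑-*ʳ (allFin n) _ (𝟙 (a Fin.≟ u))) (cong (_* 𝟙 (a Fin.≟ u)) (∑-sift (h u) b)))

-- Normalised cut and normalised modularity in terms of |E(C)| / vol(C)

mem : ∀ {n} → Subset n → Fin n → ℚ
mem C v = 𝟙 (v ∈? C)

module GraphSums (G : Graph) where
  open Graph G

  d : Vertex → ℚ
  d v = fromℕ (deg v)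

  ends-distinct : ∀ {e} → e ∈ₗ edges → proj₁ e ≢ proj₂ e
  ends-distinct e∈ = Fin.<⇒≢ (All.lookup ordered e∈)

  d≡∑ : ∀ v → d v ≡ (∑[ e ← edges ] (𝟙 (proj₁ e Fin.≟ v) + 𝟙 (proj₂ e Fin.≟ v)))
  d≡∑ v = trans (length-filter≡∑ _ edges) (∑-cong edges λ e e∈ →
    𝟙-⊎ (proj₁ e Fin.≟ v) (proj₂ e Fin.≟ v) λ (p , q) → ends-distinct e∈ (trans p (sym q)))

  -- Double counting of incidences. The weight 1 gives `handshake`, the weight `mem C` gives the
  -- volume of C.
  ∑-d : ∀ f → (∑[ v ← allFin order ] (f v * d v)) ≡ (∑[ e ← edges ] (f (proj₁ e) + f (proj₂ e)))
  ∑-d f = begin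
    (∑[ v ← allFin order ] (f v * d v))
      ≡⟨ ∑-cong (allFin order) (λ v _ → trans (cong (f v *_) (d≡∑ v)) (sym (∑-*ˡ edges (f v) _))) ⟩
    (∑[ v ← allFin order ] ∑[ e ← edges ] (f v * (𝟙 (proj₁ e Fin.≟ v) + 𝟙 (proj₂ e Fin.≟ v))))
      ≡⟨ ∑-swap (allFin order) edges _ ⟩
    (∑[ e ← edges ] ∑[ v ← allFin order ] (f v * (𝟙 (proj₁ e Fin.≟ v) + 𝟙 (proj₂ e Fin.≟ v))))
      ≡⟨ ∑-cong edges (λ e _ → trans (∑-cong (allFin order) (λ v _ → ℚ.*-distribˡ-+ (f v) _ _))
           (trans (∑-+ (allFin order) _ _) (cong₂ _+_ (∑-sift f (proj₁ e)) (∑-sift f (proj₂ e))))) ⟩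
    (∑[ e ← edges ] (f (proj₁ e) + f (proj₂ e))) ∎
    where open ≡-Reasoning

  fromℕ-vol : ∀ C → fromℕ (vol C) ≡ (∑[ v ← allFin order ] (mem C v * d v))
  fromℕ-vol C = trans (fromℕ-sum deg (filter (_∈? C) (allFin order))) (∑-filter (_∈? C) d (allFin order))

  fromℕ-E : ∀ C → fromℕ (length (E C)) ≡ (∑[ e ← edges ] (mem C (proj₁ e) * mem C (proj₂ e)))
  fromℕ-E C = trans (length-filter≡∑ _ edges)
    (∑-cong edges (λ e _ → 𝟙-× (proj₁ e ∈? C) (proj₂ e ∈? C)))

  -- An edge adds to the volume the number of its endpoints in C: two if it is inside, one if it
  -- leaves C.
  vol≡2E+E-out : ∀ C → fromℕ (vol C) ≡ fromℕ (length (E C)) + fromℕ (length (E C)) + fromℕ (length (E-out C))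
  vol≡2E+E-out C = begin
    fromℕ (vol C)
      ≡⟨ trans (fromℕ-vol C) (∑-d (mem C)) ⟩
    (∑[ e ← edges ] (mem C (proj₁ e) + mem C (proj₂ e)))
      ≡⟨ ∑-cong edges (λ e _ → split e) ⟩
    (∑[ e ← edges ] (inside e + inside e + 𝟙 (exactlyOneIn? C e)))
      ≡⟨ trans (∑-+ edges _ _) (cong (_+ ∑ edges (𝟙 ∘ exactlyOneIn? C)) (∑-+ edges _ _)) ⟩
    ∑ edges inside + ∑ edges inside + ∑ edges (𝟙 ∘ exactlyOneIn? C)
      ≡⟨ cong₂ _+_ (cong₂ _+_ (fromℕ-E C) (fromℕ-E C)) (length-filter≡∑ (exactlyOneIn? C) edges) ⟨
    fromℕ (length (E C)) + fromℕ (length (E C)) + fromℕ (length (E-out C)) ∎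
    where
    open ≡-Reasoning
    inside : Vertex × Vertex → ℚ
    inside e = mem C (proj₁ e) * mem C (proj₂ e)
    split : ∀ e → mem C (proj₁ e) + mem C (proj₂ e) ≡ inside e + inside e + 𝟙 (exactlyOneIn? C e)
    split (u , v) with u ∈? C | v ∈? C
    ... | yes _ | yes _ = refl
    ... | yes _ | no _  = refl
    ... | no _  | yes _ = refl
    ... | no _  | no _  = refl

  handshake : (∑[ v ← allFin order ] d v) ≡ fromℕ ∣E∣ + fromℕ ∣E∣
  handshake = begin
    (∑[ v ← allFin order ] d v)           ≡⟨ ∑-cong (allFin order) (λ v _ → sym (ℚ.*-identityˡ (d v))) ⟩
    (∑[ v ← allFin order ] (1ℚ * d v))    ≡⟨ ∑-d (λ _ → 1ℚ) ⟩
    (∑[ e ← edges ] (1ℚ + 1ℚ))            ≡⟨ ∑-+ edges _ _ ⟩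
    (∑[ e ← edges ] 1ℚ) + (∑[ e ← edges ] 1ℚ) ≡⟨ cong₂ _+_ (∑-one edges) (∑-one edges) ⟩
    fromℕ ∣E∣ + fromℕ ∣E∣                 ∎
    where open ≡-Reasoning

  -- The e(C) of the overview.
  score : Subset order → ℚ
  score C = fromℕ (length (E C)) * recip (vol C)

  -- Each edge claims the two ordered pairs of its endpoints, and no pair is claimed twice; the
  -- unclaimed pairs only add nonnegative terms.
  ∑-edges≤∑-pairs : ∀ (h : Vertex → Vertex → ℚ) → (∀ u v → 0ℚ ≤ h u v) →
    (∑[ e ← edges ] (h (proj₁ e) (proj₂ e) + h (proj₂ e) (proj₁ e))) ≤ (∑[ u ← allFin order ] ∑[ v ← allFin order ] h u v)
  ∑-edges≤∑-pairs h 0≤h = begin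
    (∑[ e ← edges ] (h (proj₁ e) (proj₂ e) + h (proj₂ e) (proj₁ e)))
      ≡⟨ ∑-cong edges (λ e _ → trans (cong₂ _+_ (sym (∑-sift₂ h (proj₁ e) (proj₂ e))) (sym (∑-sift₂ h (proj₂ e) (proj₁ e))))
           (trans (sym (∑-+ V _ _)) (∑-cong V (λ u _ → trans (sym (∑-+ V _ _)) (∑-cong V (λ v _ → sym (ℚ.*-distribˡ-+ (h u v) _ _))))))) ⟩
    (∑[ e ← edges ] ∑[ u ← V ] ∑[ v ← V ] (h u v * at e u v))
      ≡⟨ trans (∑-swap edges V _) (∑-cong V (λ u _ → ∑-swap edges V _)) ⟩
    (∑[ u ← V ] ∑[ v ← V ] ∑[ e ← edges ] (h u v * at e u v))
      ≡⟨ ∑-cong V (λ u _ → ∑-cong V (λ v _ → ∑-*ˡ edges (h u v) _)) ⟩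
    (∑[ u ← V ] ∑[ v ← V ] (h u v * (∑[ e ← edges ] at e u v)))
      ≤⟨ ∑-mono V (λ u _ → ∑-mono V (λ v _ → *-monoˡ (0≤h u v) (at≤1 u v))) ⟩
    (∑[ u ← V ] ∑[ v ← V ] (h u v * 1ℚ))
      ≡⟨ ∑-cong V (λ u _ → ∑-cong V (λ v _ → ℚ.*-identityʳ (h u v))) ⟩
    (∑[ u ← V ] ∑[ v ← V ] h u v) ∎
    where
    open ℚ.≤-Reasoning
    V = allFin order
    is : Vertex × Vertex → Vertex → Vertex → ℚ
    is e u v = 𝟙 (proj₁ e Fin.≟ u) * 𝟙 (proj₂ e Fin.≟ v)
    at : Vertex × Vertex → Vertex → Vertex → ℚ
    at e u v = is e u v + 𝟙 (proj₂ e Fin.≟ u) * 𝟙 (proj₁ e Fin.≟ v)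
    _≟₂_ : ∀ (e f : Vertex × Vertex) → Dec (e ≡ f)
    _≟₂_ = ≡-dec Fin._≟_ Fin._≟_
    is≡ : ∀ e u v → is e u v ≡ 𝟙 (e ≟₂ (u , v))
    is≡ e u v = trans (sym (𝟙-× (proj₁ e Fin.≟ u) (proj₂ e Fin.≟ v)))
      (𝟙-⇔ ((proj₁ e Fin.≟ u) ×-dec (proj₂ e Fin.≟ v)) (e ≟₂ (u , v)) (λ (p , q) → cong₂ _,_ p q) (λ { refl → refl , refl }))
    once : ∀ u v → (∑[ e ← edges ] is e u v) ≤ 1ℚ
    once u v = ≤-trans (≤-reflexive (∑-cong edges (λ e _ → is≡ e u v))) (∑-δ≤1 _≟₂_ (u , v) unique)
    never : ∀ {u v} → ¬ (u Fin.< v) → (∑[ e ← edges ] is e u v) ≡ 0ℚ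
    never {u} {v} u≮v = trans (∑-cong edges (λ e e∈ → trans (is≡ e u v)
      (𝟙-no (e ≟₂ (u , v)) λ { refl → u≮v (All.lookup ordered e∈) }))) (∑-zero edges)
    -- By `ordered` at most one of (u , v) and (v , u) can be stored, and by `unique` it is stored
    -- at most once.
    at≤1 : ∀ u v → (∑[ e ← edges ] at e u v) ≤ 1ℚ
    at≤1 u v = ≤-trans (≤-reflexive (trans (∑-+ edges _ _) (cong ((∑[ e ← edges ] is e u v) +_)
      (∑-cong edges (λ e _ → ℚ.*-comm (𝟙 (proj₂ e Fin.≟ u)) _))))) (bound (u Fin.<? v))
      where
      bound : Dec (u Fin.< v) → (∑[ e ← edges ] is e u v) + (∑[ e ← edges ] is e v u) ≤ 1ℚ
      bound (yes u<v) = ≤-trans (≤-reflexive (trans (cong ((∑[ e ← edges ] is e u v) +_) (never (Fin.<-asym u<v))) (ℚ.+-identityʳ _))) (once u v)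
      bound (no u≮v)  = ≤-trans (≤-reflexive (trans (cong (_+ (∑[ e ← edges ] is e v u)) (never u≮v)) (ℚ.+-identityˡ _))) (once v u)

  module _ (y : Vertex → ℚ) (0≤y : ∀ v → 0ℚ ≤ y v)
           (dual : ∀ e → e ∈ₗ edges → 1ℚ ≤ d (proj₂ e) * y (proj₁ e) + d (proj₁ e) * y (proj₂ e)) where

    -- Weak duality. Restricted to C, the hypothesis `dual` bounds each edge by the terms y u · deg
    -- v of its two ordered pairs; the sum of these terms over all of C × C factorises into Σ y
    -- times the volume.
    E≤vol*y : ∀ C → fromℕ (length (E C)) ≤ fromℕ (vol C) * (∑[ v ← allFin order ] (mem C v * y v))
    E≤vol*y C = begin
      fromℕ (length (E C))
        ≡⟨ fromℕ-E C ⟩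
      (∑[ e ← edges ] (mem C (proj₁ e) * mem C (proj₂ e)))
        ≤⟨ ∑-mono edges (λ e e∈ → edge e e∈) ⟩
      (∑[ e ← edges ] (h (proj₁ e) (proj₂ e) + h (proj₂ e) (proj₁ e)))
        ≤⟨ ∑-edges≤∑-pairs h (λ u v → 0≤* (0≤* (0≤𝟙 (u ∈? C)) (0≤y u)) (0≤* (0≤𝟙 (v ∈? C)) (0≤fromℕ (deg v)))) ⟩
      (∑[ u ← V ] ∑[ v ← V ] h u v)
        ≡⟨ trans (∑-cong V (λ u _ → ∑-*ˡ V (mem C u * y u) _)) (∑-*ʳ V _ _) ⟩
      (∑[ u ← V ] (mem C u * y u)) * (∑[ v ← V ] (mem C v * d v))
        ≡⟨ trans (ℚ.*-comm (∑[ u ← V ] (mem C u * y u)) (∑[ v ← V ] (mem C v * d v))) (cong (_* (∑[ v ← V ] (mem C v * y v))) (sym (fromℕ-vol C))) ⟩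
      fromℕ (vol C) * (∑[ v ← V ] (mem C v * y v)) ∎
      where
      open ℚ.≤-Reasoning
      V = allFin order
      h : Vertex → Vertex → ℚ
      h u v = mem C u * y u * (mem C v * d v)
      edge : ∀ e → e ∈ₗ edges → mem C (proj₁ e) * mem C (proj₂ e) ≤ h (proj₁ e) (proj₂ e) + h (proj₂ e) (proj₁ e)
      edge e@(u , v) e∈ = begin
        mem C u * mem C v                               ≡⟨ ℚ.*-identityʳ _ ⟨
        mem C u * mem C v * 1ℚ                          ≤⟨ *-monoˡ (0≤* (0≤𝟙 (u ∈? C)) (0≤𝟙 (v ∈? C))) (dual e e∈) ⟩
        mem C u * mem C v * (d v * y u + d u * y v)
          ≡⟨ solve 6 (λ a b c e f g → a :* b :* (c :* e :+ f :* g) := a :* e :* (b :* c) :+ b :* g :* (a :* f)) refl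
               (mem C u) (mem C v) (d v) (y u) (d u) (y v) ⟩
        h u v + h v u                                   ∎

  module _ (0<deg : NoIsolatedVertices) where

    0<vol : ∀ {C v} → v ∈ C → 0 ℕ.< vol C
    0<vol {C} {v} v∈C with vol C in eq
    ... | suc _ = s≤s z≤n
    ... | zero  = ⊥-elim (absurd (begin
      1ℚ                                      ≤⟨ fromℕ-mono (0<deg v) ⟩
      d v                                     ≡⟨ ℚ.*-identityˡ (d v) ⟨
      1ℚ * d v                                ≡⟨ cong (_* d v) (𝟙-yes (v ∈? C) v∈C) ⟨
      mem C v * d v                           ≤⟨ ∑-∈ {f = λ v → mem C v * d v} (λ v → 0≤* (0≤𝟙 (v ∈? C)) (0≤fromℕ (deg v))) (∈-allFin v) ⟩
      (∑[ v ← allFin order ] (mem C v * d v)) ≡⟨ trans (sym (fromℕ-vol C)) (cong fromℕ eq) ⟩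
      0ℚ                                      ∎))
      where
      open ℚ.≤-Reasoning
      absurd : ¬ (1ℚ ≤ 0ℚ)
      absurd 1≤0 = ℚ.1≢0 (ℚ.≤-antisym 1≤0 (0≤fromℕ 1))

    module _ (𝓒 : Clustering order) where
      open Clustering 𝓒

      partition-of-unity : ∀ v → (∑[ i ← allFin k ] mem (cluster i) v) ≡ 1ℚ
      partition-of-unity v with i₀ , v∈ ← covering v =
        trans (∑-cong (allFin k) (λ i _ → 𝟙-⇔ (v ∈? cluster i) (i Fin.≟ i₀) (only i) λ { refl → v∈ }))
          (∑-δ Fin._≟_ i₀ (allFin⁺ k) (∈-allFin i₀))
        where
        only : ∀ i → v ∈ cluster i → i ≡ i₀
        only i v∈′ with i Fin.≟ i₀
        ... | yes p = p
        ... | no ¬p = ⊥-elim (disjoint i i₀ ¬p (v , x∈p∩q⁺ (v∈′ , v∈)))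

      ∑-clusters : ∀ f → (∑[ i ← allFin k ] ∑[ v ← allFin order ] (mem (cluster i) v * f v)) ≡ ∑ (allFin order) f
      ∑-clusters f = trans (∑-swap (allFin k) (allFin order) _) (∑-cong (allFin order) (λ v _ →
        trans (∑-*ʳ (allFin k) _ (f v)) (trans (cong (_* f v) (partition-of-unity v)) (ℚ.*-identityˡ (f v)))))

      vol-recip : ∀ i → fromℕ (vol (cluster i)) * recip (vol (cluster i)) ≡ 1ℚ
      vol-recip i = recip-inverse (0<vol (proj₂ (nonempty i)))

      totalScore : ℚ
      totalScore = ∑[ i ← allFin k ] score (cluster i)

      -- Division of `E≤vol*y` by the volume leaves the sum of y over the cluster, and the clusters
      -- together cover each vertex exactly once.
      totalScore≤ : ∀ y → (∀ v → 0ℚ ≤ y v) →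
        (∀ e → e ∈ₗ edges → 1ℚ ≤ d (proj₂ e) * y (proj₁ e) + d (proj₁ e) * y (proj₂ e)) →
        totalScore ≤ ∑ (allFin order) y
      totalScore≤ y 0≤y dual = ≤-trans (∑-mono (allFin k) (λ i _ → bound i)) (≤-reflexive (∑-clusters y))
        where
        bound : ∀ i → score (cluster i) ≤ (∑[ v ← allFin order ] (mem (cluster i) v * y v))
        bound i = begin
          fromℕ (length (E C)) * w  ≤⟨ *-monoʳ (0≤recip (vol C)) (E≤vol*y y 0≤y dual C) ⟩
          fromℕ (vol C) * s * w     ≡⟨ solve 3 (λ a b c → a :* b :* c := a :* c :* b) refl (fromℕ (vol C)) s w ⟩
          fromℕ (vol C) * w * s     ≡⟨ trans (cong (_* s) (vol-recip i)) (ℚ.*-identityˡ s) ⟩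
          s                         ∎
          where
          open ℚ.≤-Reasoning
          C = cluster i
          w = recip (vol C)
          s = ∑[ v ← allFin order ] (mem C v * y v)

      -- Dividing `vol≡2E+E-out` by the volume shows that each cluster contributes exactly 1.
      NCut≡ : NCut G 𝓒 + (totalScore + totalScore) ≡ fromℕ k
      NCut≡ = begin
        NCut G 𝓒 + (totalScore + totalScore)
          ≡⟨ cong₂ _+_ (∑-allFin (λ i → fromℕ (length (E-out (cluster i))) ÷ℕ vol (cluster i))) (∑-+ (allFin k) (score ∘ cluster) (score ∘ cluster)) ⟨
        (∑[ i ← allFin k ] (fromℕ (length (E-out (cluster i))) ÷ℕ vol (cluster i))) + (∑[ i ← allFin k ] (score (cluster i) + score (cluster i)))
          ≡⟨ ∑-+ (allFin k) _ _ ⟨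
        (∑[ i ← allFin k ] (fromℕ (length (E-out (cluster i))) ÷ℕ vol (cluster i) + (score (cluster i) + score (cluster i))))
          ≡⟨ ∑-cong (allFin k) (λ i _ → unit i) ⟩
        (∑[ i ← allFin k ] 1ℚ)
          ≡⟨ trans (∑-one (allFin k)) (cong fromℕ (List.length-tabulate {n = k} id)) ⟩
        fromℕ k ∎
        where
        open ≡-Reasoning
        unit : ∀ i → fromℕ (length (E-out (cluster i))) ÷ℕ vol (cluster i) + (score (cluster i) + score (cluster i)) ≡ 1ℚ
        unit i = begin
          out ÷ℕ vol C + (ins * w + ins * w) ≡⟨ cong (_+ (ins * w + ins * w)) (÷ℕ-recip out (vol C)) ⟩
          out * w + (ins * w + ins * w)      ≡⟨ solve 3 (λ a b c → a :* c :+ (b :* c :+ b :* c) := (b :+ b :+ a) :* c) refl out ins w ⟩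
          (ins + ins + out) * w              ≡⟨ cong (_* w) (vol≡2E+E-out C) ⟨
          fromℕ (vol C) * w                  ≡⟨ vol-recip i ⟩
          1ℚ                                 ∎
          where
          C = cluster i
          w = recip (vol C)
          ins = fromℕ (length (E C))
          out = fromℕ (length (E-out C))

      -- The penalty vol² / 4m becomes linear in the volume after division by it, so its total 2m /
      -- 4m is the same for all clusterings. It is left unreduced, which avoids a case distinction
      -- on m = 0.
      NMod≡ : NMod G 𝓒 ≡ (totalScore - (fromℕ ∣E∣ + fromℕ ∣E∣) * recip (4 ℕ.* ∣E∣)) * recip ∣E∣
      NMod≡ = begin
        NMod G 𝓒
          ≡⟨ ∑-allFin (λ i → modularity G (cluster i) ÷ℕ vol (cluster i)) ⟨
        (∑[ i ← allFin k ] (modularity G (cluster i) ÷ℕ vol (cluster i)))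
          ≡⟨ ∑-cong (allFin k) (λ i _ → summand i) ⟩
        (∑[ i ← allFin k ] ((score (cluster i) + fromℕ (vol (cluster i)) * (- q)) * recip ∣E∣))
          ≡⟨ ∑-*ʳ (allFin k) _ (recip ∣E∣) ⟩
        (∑[ i ← allFin k ] (score (cluster i) + fromℕ (vol (cluster i)) * (- q))) * recip ∣E∣
          ≡⟨ cong (_* recip ∣E∣) (trans (∑-+ (allFin k) _ _) (cong (totalScore +_) (∑-*ʳ (allFin k) _ (- q)))) ⟩
        (totalScore + (∑[ i ← allFin k ] fromℕ (vol (cluster i))) * (- q)) * recip ∣E∣
          ≡⟨ cong (λ z → (totalScore + z * (- q)) * recip ∣E∣) total ⟩
        (totalScore + (fromℕ ∣E∣ + fromℕ ∣E∣) * (- q)) * recip ∣E∣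
          ≡⟨ cong (λ z → (totalScore + z) * recip ∣E∣) (sym (ℚ.neg-distribʳ-* (fromℕ ∣E∣ + fromℕ ∣E∣) q)) ⟩
        (totalScore - (fromℕ ∣E∣ + fromℕ ∣E∣) * q) * recip ∣E∣ ∎
        where
        open ≡-Reasoning
        q = recip (4 ℕ.* ∣E∣)
        total : (∑[ i ← allFin k ] fromℕ (vol (cluster i))) ≡ fromℕ ∣E∣ + fromℕ ∣E∣
        total = trans (∑-cong (allFin k) (λ i _ → fromℕ-vol (cluster i))) (trans (∑-clusters d) handshake)
        summand : ∀ i → modularity G (cluster i) ÷ℕ vol (cluster i) ≡ (score (cluster i) + fromℕ (vol (cluster i)) * (- q)) * recip ∣E∣
        summand i = begin
          (ins - fromℕ (vol C ℕ.* vol C) ÷ℕ (4 ℕ.* ∣E∣)) ÷ℕ ∣E∣ ÷ℕ vol C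
            ≡⟨ trans (÷ℕ-recip _ (vol C)) (cong (_* w) (÷ℕ-recip _ ∣E∣)) ⟩
          (ins - fromℕ (vol C ℕ.* vol C) ÷ℕ (4 ℕ.* ∣E∣)) * recip ∣E∣ * w
            ≡⟨ cong (λ z → (ins - z) * recip ∣E∣ * w) (trans (÷ℕ-recip _ (4 ℕ.* ∣E∣)) (cong (_* q) (fromℕ-* (vol C) (vol C)))) ⟩
          (ins - fromℕ (vol C) * fromℕ (vol C) * q) * recip ∣E∣ * w
            ≡⟨ solve 5 (λ a v q m w → (a :- v :* v :* q) :* m :* w := (a :* w :+ (v :* w) :* (v :* (:- q))) :* m) refl ins (fromℕ (vol C)) q (recip ∣E∣) w ⟩
          (ins * w + fromℕ (vol C) * w * (fromℕ (vol C) * (- q))) * recip ∣E∣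
            ≡⟨ cong (λ z → (ins * w + z) * recip ∣E∣) (trans (cong (_* (fromℕ (vol C) * (- q))) (vol-recip i)) (ℚ.*-identityˡ (fromℕ (vol C) * (- q)))) ⟩
          (ins * w + fromℕ (vol C) * (- q)) * recip ∣E∣ ∎
          where
          C = cluster i
          w = recip (vol C)
          ins = fromℕ (length (E C))

-- Star clusterings and the invariant of the greedy algorithm

lookup-injective : ∀ {A : Set} {xs : List A} → Unique xs → ∀ i j → List.lookup xs i ≡ List.lookup xs j → i ≡ j
lookup-injective (x∉ ∷ u) Fin.zero    Fin.zero    eq = refl
lookup-injective (x∉ ∷ u) Fin.zero    (Fin.suc j) eq = ⊥-elim (All.lookup x∉ (∈-lookup j) eq)
lookup-injective (x∉ ∷ u) (Fin.suc i) Fin.zero    eq = ⊥-elim (All.lookup x∉ (∈-lookup i) (sym eq))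
lookup-injective (x∉ ∷ u) (Fin.suc i) (Fin.suc j) eq = cong Fin.suc (lookup-injective u i j eq)

module _ {n} (lab : Fin n → Fin n) where

  -- Only labels in use may index clusters, as clusters are nonempty; without repetitions, distinct
  -- indices have disjoint fibres.
  usedLabels : List (Fin n)
  usedLabels = deduplicate Fin._≟_ (map lab (allFin n))

  lab∈usedLabels : ∀ v → lab v ∈ₗ usedLabels
  lab∈usedLabels v = ∈-deduplicate⁺ Fin._≟_ (∈-map⁺ lab (∈-allFin v))

  fibre : Fin n → Subset n
  fibre x = Vec.tabulate (λ v → does (lab v Fin.≟ x))

  ∈-fibre⁺ : ∀ {v x} → lab v ≡ x → v ∈ fibre x
  ∈-fibre⁺ {v} {x} eq = lookup⇒[]= v (fibre x) (trans (lookup∘tabulate _ v) (dec-true (lab v Fin.≟ x) eq))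

  ∈-fibre⁻ : ∀ {v x} → v ∈ fibre x → lab v ≡ x
  ∈-fibre⁻ {v} {x} v∈ with lab v Fin.≟ x | trans (sym (lookup∘tabulate (λ v → does (lab v Fin.≟ x)) v)) ([]=⇒lookup v∈)
  ... | yes eq | _ = eq

  byLabel : Clustering n
  byLabel = record
    { k        = length usedLabels
    ; cluster  = fibre ∘ List.lookup usedLabels
    ; nonempty = λ i → let v , _ , eq = ∈-map⁻ lab (∈-deduplicate⁻ Fin._≟_ (map lab (allFin n)) (∈-lookup i))
                       in v , ∈-fibre⁺ (sym eq)
    ; disjoint = λ i j i≢j (v , v∈) → let v∈i , v∈j = x∈p∩q⁻ _ _ v∈ in
        i≢j (lookup-injective (deduplicate-! Fin._≟_ (map lab (allFin n))) i j (trans (sym (∈-fibre⁻ v∈i)) (∈-fibre⁻ v∈j)))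
    ; covering = λ v → Any.index (lab∈usedLabels v) , ∈-fibre⁺ (lookup-index (lab∈usedLabels v))
    }

  byLabel-same : ∀ u v → (lab u ≡ lab v) ⇔ (∃ λ i → u ∈ Clustering.cluster byLabel i × v ∈ Clustering.cluster byLabel i)
  byLabel-same u v = mk⇔
    (λ eq → let i , v∈ = Clustering.covering byLabel v in i , ∈-fibre⁺ (trans eq (∈-fibre⁻ v∈)) , v∈)
    (λ (i , u∈ , v∈) → trans (∈-fibre⁻ u∈) (sym (∈-fibre⁻ v∈)))

  mem-fibre : ∀ x v → mem (fibre x) v ≡ 𝟙 (lab v Fin.≟ x)
  mem-fibre x v = 𝟙-⇔ (v ∈? fibre x) (lab v Fin.≟ x) ∈-fibre⁻ ∈-fibre⁺

-- Of a centre, num is the number and load the total degree of the leaves.  A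
-- leaf has its own degree as load, so it looks full to its other neighbours.
record Cell (V : Set) : Set where
  constructor cell
  field
    lab  : V
    load : ℕ
    num  : ℕ
    y    : ℚ
open Cell

module Stars (G : Graph) (0<deg : Graph.NoIsolatedVertices G) where
  open Graph G
  open GraphSums G

  V : List Vertex
  V = allFin order

  iv : Vertex → ℚ
  iv v = recip (deg v)

  0≤iv : ∀ v → 0ℚ ≤ iv v
  0≤iv v = 0≤recip (deg v)

  0≤d : ∀ v → 0ℚ ≤ d v
  0≤d v = 0≤fromℕ (deg v)

  d*iv : ∀ v → d v * iv v ≡ 1ℚ
  d*iv v = recip-inverse (0<deg v)

  cancel-d : ∀ v {p q} → d v * p ≤ d v * q → p ≤ q
  cancel-d v {p} {q} h = subst₂ _≤_ (un p) (un q) (*-monoˡ (0≤iv v) h)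
    where
    un : ∀ p → iv v * (d v * p) ≡ p
    un p = trans (solve 3 (λ a b c → a :* (b :* c) := b :* a :* c) refl (iv v) (d v) p)
                 (trans (cong (_* p) (d*iv v)) (ℚ.*-identityˡ p))

  record Local (K : ℕ) (w : Vertex) (c : Cell Vertex) : Set where
    field
      0≤y    : 0ℚ ≤ y c
      -- At K = deg w + deg w′ a full w satisfies 1 ≤ deg w′ · y w by this bound.
      budget : fromℕ (load c) + d w * (d w * y c) ≤ fromℕ K * (d w * y c)
      used   : load c ≡ 0 ⊎ deg w ℕ.≤ load c ⊎ 1ℚ ≤ d w * y c
      idle   : load c ≡ 0 → y c ≡ 0ℚ × num c ≡ 0
      free   : load c ℕ.< deg w → lab c ≡ w
      load≤  : load c ℕ.≤ deg w ℕ.+ deg w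

  Cells : Set
  Cells = Vertex → Cell Vertex

  in[_] : (Vertex → Cell Vertex) → Vertex → Vertex → ℚ
  in[ S ] x w = 𝟙 (lab (S w) Fin.≟ x)

  0≤in : ∀ (S : Cells) x w → 0ℚ ≤ in[ S ] x w
  0≤in S x w = 0≤𝟙 (lab (S w) Fin.≟ x)

  -- Expressed through labels instead of the sets `fibre x`, so that a join changes them summand by
  -- summand; `mem-fibre` translates at the end.
  volₓ yₓ Eₓ : Cells → Vertex → ℚ
  volₓ S x = ∑[ w ← V ] (in[ S ] x w * d w)
  yₓ   S x = ∑[ w ← V ] (in[ S ] x w * y (S w))
  Eₓ   S x = ∑[ e ← edges ] (in[ S ] x (proj₁ e) * in[ S ] x (proj₂ e))

  -- In `vol≤` equality would fail once x becomes a leaf: its own class is then empty, but d x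
  -- remains on the right. In `y≤` the 2 arises because each leaf of x brings 1 / deg x twice into
  -- the class of x, to itself and to the centre.
  record Inv (K : ℕ) (S : Cells) : Set where
    field
      local : ∀ w → Local K w (S w)
      vol≤  : ∀ x → volₓ S x ≤ d x + fromℕ (load (S x))
      y≤    : ∀ x → yₓ S x * d x ≤ fromℕ (num (S x)) + fromℕ (num (S x))
      num≤  : ∀ x → fromℕ (num (S x)) ≤ Eₓ S x

  start : Cells
  start w = cell w 0 0 0ℚ

  start-inv : Inv 0 start
  start-inv = record
    { local = λ w → record
      { 0≤y    = ≤-refl
      ; budget = ≤-reflexive (solve 1 (λ a → con 0ℚ :+ a :* (a :* con 0ℚ) := con 0ℚ :* (a :* con 0ℚ)) refl (d w))
      ; used   = inj₁ refl
      ; idle   = λ _ → refl , refl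
      ; free   = λ _ → refl
      ; load≤  = z≤n
      }
    ; vol≤ = λ x → ≤-reflexive (trans (∑-cong V (λ w _ → trans (ℚ.*-comm (𝟙 (w Fin.≟ x)) (d w))
               (cong (d w *_) (𝟙-⇔ (w Fin.≟ x) (x Fin.≟ w) sym sym)))) (trans (∑-sift d x) (sym (ℚ.+-identityʳ (d x)))))
    ; y≤   = λ x → ≤-reflexive (trans (cong (_* d x) (trans (∑-cong V (λ w _ → ℚ.*-zeroʳ (𝟙 (w Fin.≟ x)))) (∑-zero V))) (ℚ.*-zeroˡ (d x)))
    ; num≤ = λ x → ∑-nonNeg edges (λ e → 0≤* (0≤in start x (proj₁ e)) (0≤in start x (proj₂ e)))
    }

  Local-mono : ∀ {K K′ w c} → K ℕ.≤ K′ → Local K w c → Local K′ w c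
  Local-mono {w = w} K≤K′ L = record
    { Local L
    ; budget = ≤-trans (Local.budget L) (*-monoʳ (0≤* (0≤d w) (Local.0≤y L)) (fromℕ-mono K≤K′))
    }

  Inv-mono : ∀ {K K′ S} → K ℕ.≤ K′ → Inv K S → Inv K′ S
  Inv-mono K≤K′ I = record { Inv I ; local = λ w → Local-mono K≤K′ (Inv.local I w) }

  Priced : Cells → Vertex → Vertex → Set
  Priced S u v = 1ℚ ≤ d v * y (S u) + d u * y (S v)

  Priced-sym : ∀ {S u v} → Priced S u v → Priced S v u
  Priced-sym {S} {u} {v} = subst (1ℚ ≤_) (ℚ.+-comm (d v * y (S u)) (d u * y (S v)))

  -- At this K the budget reads load ≤ (K - deg w) · deg w · y = deg w · (deg w′ · y). Together with
  -- deg w ≤ load this allows deg w to be cancelled.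
  saturated : ∀ {c w w′} → Local (deg w ℕ.+ deg w′) w c → deg w ℕ.≤ load c → 1ℚ ≤ d w′ * y c
  saturated {c} {w} {w′} L full = cancel-d w (≤-trans (≤-reflexive (ℚ.*-identityʳ (d w))) (≤-trans (fromℕ-mono full)
    (subst₂ _≤_ (solve 2 (λ l a → l :+ a :- a := l) refl (fromℕ (load c)) a)
                (trans (cong (λ k → k * (d w * y c) - a) (fromℕ-+ (deg w) (deg w′)))
                       (solve 3 (λ a b z → (a :+ b) :* (a :* z) :- a :* (a :* z) := a :* (b :* z)) refl (d w) (d w′) (y c)))
                (ℚ.+-monoˡ-≤ (- a) (Local.budget L)))))
    where a = d w * (d w * y c)

  module _ {S : Cells} {u v : Vertex} (I : Inv (deg u ℕ.+ deg v) S) (du≤dv : deg u ℕ.≤ deg v) where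
    open Inv I

    private
      Lu = local u
      Lv = local v

    priced-u : 1ℚ ≤ d v * y (S u) → Priced S u v
    priced-u h = ≤-trans h (≤-trans (≤-reflexive (sym (ℚ.+-identityʳ _))) (ℚ.+-monoʳ-≤ (d v * y (S u)) (0≤* (0≤d u) (Local.0≤y Lv))))

    -- A loaded u is either full, which includes every leaf and is the case of `saturated`, or a
    -- centre that has received 1 / deg u at least once; then deg u ≤ deg v finishes.
    skip-used : load (S u) ≢ 0 → Priced S u v
    skip-used u≢0 with Local.used Lu
    ... | inj₁ u≡0         = ⊥-elim (u≢0 u≡0)
    ... | inj₂ (inj₁ full) = priced-u (saturated Lu full)
    ... | inj₂ (inj₂ 1≤)   = priced-u (≤-trans 1≤ (*-monoʳ (Local.0≤y Lu) (fromℕ-mono du≤dv)))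

    skip-full : deg v ℕ.≤ load (S v) → Priced S u v
    skip-full full = ≤-trans (saturated (subst (λ k → Local k v (S v)) (ℕ.+-comm (deg u) (deg v)) Lv) full)
      (≤-trans (≤-reflexive (sym (ℚ.+-identityˡ _))) (ℚ.+-monoˡ-≤ (d u * y (S v)) (0≤* (0≤d v) (Local.0≤y Lu))))

    cellᵤ : Cell Vertex
    cellᵤ = cell v (deg u) 0 (iv v)

    joined : Cell Vertex → Cell Vertex
    joined c = cell (lab c) (load c ℕ.+ deg u) (suc (num c)) (y c + iv v)

    join : Cells
    join = updateAt (updateAt S v joined) u (const cellᵤ)

    module _ (u≢v : u ≢ v) (u≡0 : load (S u) ≡ 0) (v-free : load (S v) ℕ.< deg v) where

      join-u : join u ≡ cellᵤ
      join-u = updateAt-updates u (updateAt S v joined)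

      join-v : join v ≡ joined (S v)
      join-v = trans (updateAt-minimal v u _ (u≢v ∘ sym)) (updateAt-updates v S)

      join-other : ∀ {w} → w ≢ u → w ≢ v → join w ≡ S w
      join-other {w} w≢u w≢v = trans (updateAt-minimal w u _ w≢u) (updateAt-minimal w v S w≢v)

      -- Only two cells change. Taking the cell as an argument of P lets a single case split serve
      -- all later facts about `join`.
      join-elim : ∀ (P : Vertex → Cell Vertex → Set) → P u cellᵤ → P v (joined (S v)) →
                  (∀ w → w ≢ u → w ≢ v → P w (S w)) → ∀ w → P w (join w)
      join-elim P pu pv pw w with w Fin.≟ u | w Fin.≟ v
      ... | yes refl | _        = subst (P u) (sym join-u) pu
      ... | no _     | yes refl = subst (P v) (sym join-v) pv
      ... | no w≢u   | no w≢v   = subst (P w) (sym (join-other w≢u w≢v)) (pw w w≢u w≢v)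

      lab-u : lab (S u) ≡ u
      lab-u = Local.free Lu (subst (ℕ._< deg u) (sym u≡0) (0<deg u))

      lab-v : lab (S v) ≡ v
      lab-v = Local.free Lv v-free

      y-u : y (S u) ≡ 0ℚ
      y-u = proj₁ (Local.idle Lu u≡0)

      y-join : ∀ w → y (S w) ≤ y (join w)
      y-join = join-elim (λ w c → y (S w) ≤ y c) (≤-trans (≤-reflexive y-u) (0≤iv v))
        (≤-trans (≤-reflexive (sym (ℚ.+-identityʳ _))) (ℚ.+-monoʳ-≤ (y (S v)) (0≤iv v))) (λ _ _ _ → ≤-refl)

      load-join : ∀ w → load (S w) ℕ.≤ load (join w)
      load-join = join-elim (λ w c → load (S w) ℕ.≤ load c) (ℕ.≤-trans (ℕ.≤-reflexive u≡0) z≤n) (ℕ.m≤m+n _ _) (λ _ _ _ → ℕ.≤-refl)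

      -- The fresh payment 1 / deg v to u covers the edge by itself.
      join-priced : Priced join u v
      join-priced = begin
        1ℚ                                      ≡⟨ trans (ℚ.+-identityʳ (d v * iv v)) (d*iv v) ⟨
        d v * iv v + 0ℚ                         ≤⟨ ℚ.+-monoʳ-≤ (d v * iv v) (0≤* (0≤d u) (≤-trans (Local.0≤y Lv) (y-join v))) ⟩
        d v * iv v + d u * y (join v)           ≡⟨ cong (λ c → d v * y c + d u * y (join v)) join-u ⟨
        d v * y (join u) + d u * y (join v)     ∎
        where open ℚ.≤-Reasoning

      join-local : ∀ w → Local (deg u ℕ.+ deg v) w (join w)
      join-local = join-elim (Local (deg u ℕ.+ deg v))
        (record
          { 0≤y    = 0≤iv v
          -- For a leaf the budget at its own key is an equality: with deg u · y u = deg u / deg v,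
          -- both sides are (deg u + deg v) · deg u / deg v.
          ; budget = ≤-reflexive (trans (cong (_+ d u * (d u * iv v)) (trans (sym (ℚ.*-identityʳ (d u))) (cong (d u *_) (sym (d*iv v)))))
              (trans (solve 3 (λ a b i → a :* (b :* i) :+ a :* (a :* i) := (a :+ b) :* (a :* i)) refl (d u) (d v) (iv v))
                     (cong (_* (d u * iv v)) (sym (fromℕ-+ (deg u) (deg v))))))
          ; used   = inj₂ (inj₁ ℕ.≤-refl)
          ; idle   = λ z → ⊥-elim (ℕ.<-irrefl (sym z) (0<deg u))
          ; free   = λ lt → ⊥-elim (ℕ.<-irrefl refl lt)
          ; load≤  = ℕ.m≤m+n _ _
          })
        (record
          { 0≤y    = 0≤+ (Local.0≤y Lv) (0≤iv v)
          ; budget = budget-v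
          ; used   = inj₂ (inj₂ (≤-trans (≤-reflexive (sym (trans (ℚ.+-identityˡ _) (d*iv v))))
              (≤-trans (ℚ.+-monoˡ-≤ (d v * iv v) (0≤* (0≤d v) (Local.0≤y Lv))) (≤-reflexive (sym (ℚ.*-distribˡ-+ (d v) _ _))))))
          ; idle   = λ z → ⊥-elim (ℕ.<-irrefl (sym (ℕ.m+n≡0⇒n≡0 (load (S v)) z)) (0<deg u))
          ; free   = λ _ → lab-v
          -- The load was below deg v and grows by deg u ≤ deg v. The resulting 2 deg v, with deg v
          -- for the centre itself, is the origin of `vol≤3d`.
          ; load≤  = ℕ.+-mono-≤ (ℕ.<⇒≤ v-free) du≤dv
          })
        (λ w _ _ → local w)
        where
        -- A new leaf raises deg v · y v by 1 and the load by deg u, so both sides grow by exactly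
        -- deg u + deg v, the current K.
        budget-v : fromℕ (load (S v) ℕ.+ deg u) + d v * (d v * (y (S v) + iv v)) ≤ fromℕ (deg u ℕ.+ deg v) * (d v * (y (S v) + iv v))
        budget-v = begin
          fromℕ (load (S v) ℕ.+ deg u) + d v * (d v * (y (S v) + iv v))
            ≡⟨ cong (_+ d v * (d v * (y (S v) + iv v))) (fromℕ-+ (load (S v)) (deg u)) ⟩
          l + d u + d v * (d v * (y (S v) + iv v))
            ≡⟨ solve 5 (λ l a b z i → l :+ a :+ b :* (b :* (z :+ i)) := l :+ b :* (b :* z) :+ (a :+ b :* (b :* i))) refl l (d u) (d v) (y (S v)) (iv v) ⟩
          l + d v * (d v * y (S v)) + (d u + d v * (d v * iv v))
            ≤⟨ ℚ.+-mono-≤ (Local.budget Lv) (≤-reflexive (trans (cong (λ z → d u + d v * z) (d*iv v))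
                 (trans (cong (d u +_) (ℚ.*-identityʳ (d v))) (trans (sym (ℚ.*-identityʳ _)) (cong₂ _*_ (sym (fromℕ-+ (deg u) (deg v))) (sym (d*iv v))))))) ⟩
          k * (d v * y (S v)) + k * (d v * iv v)
            ≡⟨ solve 4 (λ k b z i → k :* (b :* z) :+ k :* (b :* i) := k :* (b :* (z :+ i))) refl k (d v) (y (S v)) (iv v) ⟩
          k * (d v * (y (S v) + iv v)) ∎
          where
          open ℚ.≤-Reasoning
          l = fromℕ (load (S v))
          k = fromℕ (deg u ℕ.+ deg v)

      in-gain : ∀ x w → w ≢ u → in[ join ] x w ≡ in[ S ] x w
      in-gain x w w≢u = cong (λ z → 𝟙 (z Fin.≟ x)) (lab-same w w≢u)
        where
        lab-same : ∀ w → w ≢ u → lab (join w) ≡ lab (S w)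
        lab-same = join-elim (λ w c → w ≢ u → lab c ≡ lab (S w)) (λ u≢u → ⊥-elim (u≢u refl)) (λ _ → refl) (λ _ _ _ _ → refl)

      in-u : ∀ x → in[ join ] x u ≡ 𝟙 (v Fin.≟ x)
      in-u x = cong (λ c → 𝟙 (lab c Fin.≟ x)) join-u

      -- Only u changes its class. What its old class loses is ignored, which suffices for an upper
      -- bound.
      vol-join : ∀ x → volₓ join x ≤ volₓ S x + 𝟙 (v Fin.≟ x) * d u
      vol-join x = begin
        (∑[ w ← V ] (in[ join ] x w * d w))
          ≤⟨ ∑-mono V (λ w _ → pointwise w (w Fin.≟ u)) ⟩
        (∑[ w ← V ] (in[ S ] x w * d w + 𝟙 (v Fin.≟ x) * d w * 𝟙 (u Fin.≟ w)))
          ≡⟨ ∑-+ V _ _ ⟩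
        volₓ S x + (∑[ w ← V ] (𝟙 (v Fin.≟ x) * d w * 𝟙 (u Fin.≟ w)))
          ≡⟨ cong (volₓ S x +_) (∑-sift (λ w → 𝟙 (v Fin.≟ x) * d w) u) ⟩
        volₓ S x + 𝟙 (v Fin.≟ x) * d u ∎
        where
        open ℚ.≤-Reasoning
        pointwise : ∀ w → Dec (w ≡ u) → in[ join ] x w * d w ≤ in[ S ] x w * d w + 𝟙 (v Fin.≟ x) * d w * 𝟙 (u Fin.≟ w)
        pointwise w (yes refl) = begin
          in[ join ] x u * d u                                       ≡⟨ cong (_* d u) (in-u x) ⟩
          𝟙 (v Fin.≟ x) * d u                                        ≡⟨ trans (ℚ.+-identityˡ _) (ℚ.*-identityʳ _) ⟨
          0ℚ + 𝟙 (v Fin.≟ x) * d u * 1ℚ                              ≤⟨ ℚ.+-monoˡ-≤ _ (0≤* (0≤in S x u) (0≤d u)) ⟩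
          in[ S ] x u * d u + 𝟙 (v Fin.≟ x) * d u * 1ℚ               ≡⟨ cong (λ z → in[ S ] x u * d u + 𝟙 (v Fin.≟ x) * d u * z) (𝟙-yes (u Fin.≟ u) refl) ⟨
          in[ S ] x u * d u + 𝟙 (v Fin.≟ x) * d u * 𝟙 (u Fin.≟ u)    ∎
        pointwise w (no w≢u) = begin
          in[ join ] x w * d w         ≡⟨ cong (_* d w) (in-gain x w w≢u) ⟩
          in[ S ] x w * d w            ≡⟨ ℚ.+-identityʳ _ ⟨
          in[ S ] x w * d w + 0ℚ       ≤⟨ ℚ.+-monoʳ-≤ (in[ S ] x w * d w) (0≤* (0≤* (0≤𝟙 (v Fin.≟ x)) (0≤d w)) (0≤𝟙 (u Fin.≟ w))) ⟩
          in[ S ] x w * d w + 𝟙 (v Fin.≟ x) * d w * 𝟙 (u Fin.≟ w) ∎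

      yₓ-join : ∀ x → yₓ join x ≤ yₓ S x + 𝟙 (v Fin.≟ x) * (iv v + iv v)
      yₓ-join x = begin
        (∑[ w ← V ] (in[ join ] x w * y (join w)))
          ≤⟨ ∑-mono V (λ w _ → pointwise w) ⟩
        (∑[ w ← V ] (in[ S ] x w * y (S w) + (g * 𝟙 (u Fin.≟ w) + g * 𝟙 (v Fin.≟ w))))
          ≡⟨ trans (∑-+ V _ _) (cong (yₓ S x +_) (∑-+ V _ _)) ⟩
        yₓ S x + ((∑[ w ← V ] (g * 𝟙 (u Fin.≟ w))) + (∑[ w ← V ] (g * 𝟙 (v Fin.≟ w))))
          ≡⟨ cong (yₓ S x +_) (trans (cong₂ _+_ (∑-sift (const g) u) (∑-sift (const g) v)) (sym (ℚ.*-distribˡ-+ (𝟙 (v Fin.≟ x)) (iv v) (iv v)))) ⟩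
        yₓ S x + 𝟙 (v Fin.≟ x) * (iv v + iv v) ∎
        where
        open ℚ.≤-Reasoning
        g = 𝟙 (v Fin.≟ x) * iv v
        0≤g : 0ℚ ≤ g
        0≤g = 0≤* (0≤𝟙 (v Fin.≟ x)) (0≤iv v)
        Bound : Vertex → Cell Vertex → Set
        Bound w c = 𝟙 (lab c Fin.≟ x) * y c ≤ in[ S ] x w * y (S w) + (g * 𝟙 (u Fin.≟ w) + g * 𝟙 (v Fin.≟ w))
        pointwise : ∀ w → Bound w (join w)
        pointwise = join-elim Bound
          (begin
            g
              ≡⟨ solve 1 (λ g → con 0ℚ :+ (g :* con 1ℚ :+ con 0ℚ) := g) refl g ⟨
            0ℚ + (g * 1ℚ + 0ℚ)
              ≤⟨ ℚ.+-mono-≤ (0≤* (0≤in S x u) (Local.0≤y Lu)) (ℚ.+-mono-≤ (≤-reflexive (cong (g *_) (sym (𝟙-yes (u Fin.≟ u) refl)))) (0≤* 0≤g (0≤𝟙 (v Fin.≟ u)))) ⟩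
            in[ S ] x u * y (S u) + (g * 𝟙 (u Fin.≟ u) + g * 𝟙 (v Fin.≟ u)) ∎)
          (begin
            in[ S ] x v * (y (S v) + iv v)
              ≡⟨ ℚ.*-distribˡ-+ (in[ S ] x v) (y (S v)) (iv v) ⟩
            in[ S ] x v * y (S v) + in[ S ] x v * iv v
              ≡⟨ cong (λ z → in[ S ] x v * y (S v) + 𝟙 (z Fin.≟ x) * iv v) lab-v ⟩
            in[ S ] x v * y (S v) + g
              ≡⟨ cong (in[ S ] x v * y (S v) +_) (solve 1 (λ g → con 0ℚ :+ g :* con 1ℚ := g) refl g) ⟨
            in[ S ] x v * y (S v) + (0ℚ + g * 1ℚ)
              ≤⟨ ℚ.+-monoʳ-≤ (in[ S ] x v * y (S v)) (ℚ.+-mono-≤ (0≤* 0≤g (0≤𝟙 (u Fin.≟ v))) (≤-reflexive (cong (g *_) (sym (𝟙-yes (v Fin.≟ v) refl))))) ⟩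
            in[ S ] x v * y (S v) + (g * 𝟙 (u Fin.≟ v) + g * 𝟙 (v Fin.≟ v)) ∎)
          (λ w _ _ → ≤-trans (≤-reflexive (sym (ℚ.+-identityʳ _)))
            (ℚ.+-monoʳ-≤ (in[ S ] x w * y (S w)) (0≤+ (0≤* 0≤g (0≤𝟙 (u Fin.≟ w))) (0≤* 0≤g (0≤𝟙 (v Fin.≟ w))))))

      -- The only vertex that moves is u, and it carried its own label before. Hence only the class
      -- of u can shrink, and that class needs no edges, since `num` is 0 at u after the join.
      in-mono : ∀ x w → x ≢ u → in[ S ] x w ≤ in[ join ] x w
      in-mono x w x≢u with w Fin.≟ u
      ... | yes refl = ≤-trans (≤-reflexive (𝟙-no (lab (S u) Fin.≟ x) (λ eq → x≢u (trans (sym eq) lab-u)))) (0≤in join x u)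
      ... | no w≢u   = ≤-reflexive (sym (in-gain x w w≢u))

      _≟ₑ_ : ∀ (e f : Vertex × Vertex) → Dec (e ≡ f)
      _≟ₑ_ = ≡-dec Fin._≟_ Fin._≟_

      module _ {e} (e∈ : e ∈ₗ edges) (ends : e ≡ (u , v) ⊎ e ≡ (v , u)) where

        private
          both : Cells → Vertex → Vertex × Vertex → ℚ
          both S x f = in[ S ] x (proj₁ f) * in[ S ] x (proj₂ f)

          both-mono : ∀ x f → x ≢ u → both S x f ≤ both join x f
          both-mono x f x≢u = ≤-trans (*-monoˡ (0≤in S x (proj₁ f)) (in-mono x (proj₂ f) x≢u))
                                      (*-monoʳ (0≤in join x (proj₂ f)) (in-mono x (proj₁ f) x≢u))

          u∉ : in[ S ] v u ≡ 0ℚ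
          u∉ = 𝟙-no (lab (S u) Fin.≟ v) (λ eq → u≢v (trans (sym lab-u) eq))
          u∈′ : in[ join ] v u ≡ 1ℚ
          u∈′ = trans (in-u v) (𝟙-yes (v Fin.≟ v) refl)
          v∈′ : in[ join ] v v ≡ 1ℚ
          v∈′ = trans (in-gain v v (u≢v ∘ sym)) (𝟙-yes (lab (S v) Fin.≟ v) lab-v)

          before : ∀ {e} → e ≡ (u , v) ⊎ e ≡ (v , u) → both S v e ≡ 0ℚ
          before (inj₁ refl) = trans (cong (_* in[ S ] v v) u∉) (ℚ.*-zeroˡ (in[ S ] v v))
          before (inj₂ refl) = trans (cong (in[ S ] v v *_) u∉) (ℚ.*-zeroʳ (in[ S ] v v))
          after : ∀ {e} → e ≡ (u , v) ⊎ e ≡ (v , u) → both join v e ≡ 1ℚ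
          after (inj₁ refl) = cong₂ _*_ u∈′ v∈′
          after (inj₂ refl) = cong₂ _*_ v∈′ u∈′

        -- The edge e is new in the class of v: its endpoint u was outside before. No other edge is
        -- lost, by `in-mono` with v ≢ u.
        E-gain : Eₓ S v + 1ℚ ≤ Eₓ join v
        E-gain = begin
          Eₓ S v + 1ℚ                                   ≡⟨ cong (Eₓ S v +_) (∑-δ _≟ₑ_ e unique e∈) ⟨
          Eₓ S v + (∑[ f ← edges ] 𝟙 (f ≟ₑ e))          ≡⟨ ∑-+ edges _ _ ⟨
          (∑[ f ← edges ] (both S v f + 𝟙 (f ≟ₑ e)))    ≤⟨ ∑-mono edges (λ f _ → pointwise f (f ≟ₑ e)) ⟩
          Eₓ join v                                     ∎
          where
          open ℚ.≤-Reasoning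
          pointwise : ∀ f → (p : Dec (f ≡ e)) → both S v f + 𝟙 p ≤ both join v f
          pointwise f (yes refl) = ≤-reflexive (trans (cong (_+ 1ℚ) (before ends)) (trans (ℚ.+-identityˡ 1ℚ) (sym (after ends))))
          pointwise f (no _)     = ≤-trans (≤-reflexive (ℚ.+-identityʳ _)) (both-mono v f (u≢v ∘ sym))

        join-inv : Inv (deg u ℕ.+ deg v) join
        join-inv = record
          { local = join-local
          ; vol≤  = vol′
          ; y≤    = join-elim (λ x c → yₓ join x * d x ≤ fromℕ (num c) + fromℕ (num c)) y-at-u y-at-v y-elsewhere
          ; num≤  = join-elim (λ x c → fromℕ (num c) ≤ Eₓ join x)
              (∑-nonNeg edges (λ f → 0≤* (0≤in join u (proj₁ f)) (0≤in join u (proj₂ f))))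
              (≤-trans (≤-reflexive (trans (fromℕ-+ 1 (num (S v))) (ℚ.+-comm 1ℚ (fromℕ (num (S v)))))) (≤-trans (ℚ.+-monoˡ-≤ 1ℚ (num≤ v)) E-gain))
              (λ x x≢u _ → ≤-trans (num≤ x) (∑-mono edges (λ f _ → both-mono x f x≢u)))
          }
          where
          vol′ : ∀ x → volₓ join x ≤ d x + fromℕ (load (join x))
          vol′ x = ≤-trans (vol-join x) (≤-trans (ℚ.+-monoˡ-≤ (𝟙 (v Fin.≟ x) * d u) (vol≤ x)) (last (v Fin.≟ x)))
            where
            last : (p : Dec (v ≡ x)) → d x + fromℕ (load (S x)) + 𝟙 p * d u ≤ d x + fromℕ (load (join x))
            last (yes refl) = ≤-reflexive (trans (cong (d v + fromℕ (load (S v)) +_) (ℚ.*-identityˡ (d u)))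
              (trans (ℚ.+-assoc (d v) _ (d u)) (cong (d v +_) (trans (sym (fromℕ-+ (load (S v)) (deg u))) (cong (fromℕ ∘ load) (sym join-v))))))
            last (no _) = ≤-trans (≤-reflexive (trans (cong (d x + fromℕ (load (S x)) +_) (ℚ.*-zeroˡ (d u))) (ℚ.+-identityʳ _)))
              (ℚ.+-monoʳ-≤ (d x) (fromℕ-mono (load-join x)))

          y-same : ∀ x → v ≢ x → yₓ join x * d x ≤ fromℕ (num (S x)) + fromℕ (num (S x))
          y-same x v≢x = ≤-trans (*-monoʳ (0≤d x) (≤-trans (yₓ-join x) (≤-reflexive
            (trans (cong (λ z → yₓ S x + z * (iv v + iv v)) (𝟙-no (v Fin.≟ x) v≢x)) (trans (cong (yₓ S x +_) (ℚ.*-zeroˡ (iv v + iv v))) (ℚ.+-identityʳ (yₓ S x))))))) (y≤ x)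

          -- The new cell of u has `num` 0; so had the old one, by `idle`.
          y-at-u : yₓ join u * d u ≤ 0ℚ + 0ℚ
          y-at-u = subst (λ k → yₓ join u * d u ≤ fromℕ k + fromℕ k) (proj₂ (Local.idle Lu u≡0)) (y-same u (u≢v ∘ sym))

          y-elsewhere : ∀ x → x ≢ u → x ≢ v → yₓ join x * d x ≤ fromℕ (num (S x)) + fromℕ (num (S x))
          y-elsewhere x _ x≢v = y-same x (x≢v ∘ sym)

          y-at-v : yₓ join v * d v ≤ fromℕ (suc (num (S v))) + fromℕ (suc (num (S v)))
          y-at-v = begin
            yₓ join v * d v
              ≤⟨ *-monoʳ (0≤d v) (yₓ-join v) ⟩
            (yₓ S v + 𝟙 (v Fin.≟ v) * (iv v + iv v)) * d v
              ≡⟨ cong (λ z → (yₓ S v + z * (iv v + iv v)) * d v) (𝟙-yes (v Fin.≟ v) refl) ⟩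
            (yₓ S v + 1ℚ * (iv v + iv v)) * d v
              ≡⟨ solve 3 (λ s i a → (s :+ con 1ℚ :* (i :+ i)) :* a := s :* a :+ (a :* i :+ a :* i)) refl (yₓ S v) (iv v) (d v) ⟩
            yₓ S v * d v + (d v * iv v + d v * iv v)
              ≡⟨ cong (λ z → yₓ S v * d v + (z + z)) (d*iv v) ⟩
            yₓ S v * d v + (1ℚ + 1ℚ)
              ≤⟨ ℚ.+-monoˡ-≤ (1ℚ + 1ℚ) (y≤ v) ⟩
            fromℕ (num (S v)) + fromℕ (num (S v)) + (1ℚ + 1ℚ)
              ≡⟨ solve 1 (λ a → a :+ a :+ (con 1ℚ :+ con 1ℚ) := con 1ℚ :+ a :+ (con 1ℚ :+ a)) refl (fromℕ (num (S v))) ⟩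
            1ℚ + fromℕ (num (S v)) + (1ℚ + fromℕ (num (S v)))
              ≡⟨ cong₂ _+_ (fromℕ-+ 1 (num (S v))) (fromℕ-+ 1 (num (S v))) ⟨
            fromℕ (suc (num (S v))) + fromℕ (suc (num (S v))) ∎
            where open ℚ.≤-Reasoning

  module _ {K} {S : Cells} (I : Inv K S) where
    open Inv I

    -- Inserting 1 = vol(C) / vol(C) lets vol(C) ≤ 3 deg x meet Y · deg x ≤ 2 |E(C)|, where Y is the
    -- payment inside the class of x; 6 is the product of these two constants.
    ∑y≤6score : ∑ V (y ∘ S) ≤ fromℕ 6 * totalScore 0<deg (byLabel (lab ∘ S))
    ∑y≤6score = begin
      ∑ V (y ∘ S)
        ≡⟨ ∑-clusters 0<deg 𝓒 (y ∘ S) ⟨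
      (∑[ i ← allFin k ] ∑[ v ← V ] (mem (cluster i) v * y (S v)))
        ≤⟨ ∑-mono (allFin k) (λ i _ → bound i) ⟩
      (∑[ i ← allFin k ] (fromℕ 6 * score (cluster i)))
        ≡⟨ ∑-*ˡ (allFin k) (fromℕ 6) _ ⟩
      fromℕ 6 * totalScore 0<deg 𝓒 ∎
      where
      open ℚ.≤-Reasoning
      𝓒 = byLabel (lab ∘ S)
      open Clustering 𝓒
      bound : ∀ i → (∑[ v ← V ] (mem (cluster i) v * y (S v))) ≤ fromℕ 6 * score (cluster i)
      bound i = begin
        (∑[ v ← V ] (mem C v * y (S v)))
          ≡⟨ ∑-cong V (λ v _ → cong (_* y (S v)) (mem-fibre (lab ∘ S) x v)) ⟩
        Y
          ≡⟨ trans (cong (Y *_) (vol-recip 0<deg 𝓒 i)) (ℚ.*-identityʳ Y) ⟨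
        Y * (fromℕ (vol C) * w)
          ≡⟨ ℚ.*-assoc Y _ w ⟨
        Y * fromℕ (vol C) * w
          ≤⟨ *-monoʳ (0≤recip (vol C)) (*-monoˡ 0≤Y vol≤3d) ⟩
        Y * (fromℕ 3 * d x) * w
          ≡⟨ cong (_* w) (solve 3 (λ a b c → a :* (c :* b) := c :* (a :* b)) refl Y (d x) (fromℕ 3)) ⟩
        fromℕ 3 * (Y * d x) * w
          ≤⟨ *-monoʳ (0≤recip (vol C)) (*-monoˡ (0≤fromℕ 3) (≤-trans (y≤ x) (ℚ.+-mono-≤ (num≤ x) (num≤ x)))) ⟩
        fromℕ 3 * (Eₓ S x + Eₓ S x) * w
          ≡⟨ solve 2 (λ a b → con (fromℕ 3) :* (a :+ a) :* b := con (fromℕ 6) :* (a :* b)) refl (Eₓ S x) w ⟩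
        fromℕ 6 * (Eₓ S x * w)
          ≡⟨ cong (λ z → fromℕ 6 * (z * w)) E≡ ⟨
        fromℕ 6 * score C ∎
        where
        C = cluster i
        x = List.lookup (usedLabels (lab ∘ S)) i
        w = recip (vol C)
        Y = yₓ S x
        0≤Y : 0ℚ ≤ Y
        0≤Y = ∑-nonNeg V (λ v → 0≤* (0≤in S x v) (Local.0≤y (local v)))
        E≡ : fromℕ (length (E C)) ≡ Eₓ S x
        E≡ = trans (fromℕ-E C) (∑-cong edges (λ e _ → cong₂ _*_ (mem-fibre (lab ∘ S) x (proj₁ e)) (mem-fibre (lab ∘ S) x (proj₂ e))))
        vol≤3d : fromℕ (vol C) ≤ fromℕ 3 * d x
        vol≤3d = begin
          fromℕ (vol C)                     ≡⟨ trans (fromℕ-vol C) (∑-cong V (λ v _ → cong (_* d v) (mem-fibre (lab ∘ S) x v))) ⟩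
          volₓ S x                          ≤⟨ vol≤ x ⟩
          d x + fromℕ (load (S x))          ≤⟨ ℚ.+-monoʳ-≤ (d x) (fromℕ-mono (Local.load≤ (local x))) ⟩
          d x + fromℕ (deg x ℕ.+ deg x)     ≡⟨ cong (d x +_) (fromℕ-+ (deg x) (deg x)) ⟩
          d x + (d x + d x)                 ≡⟨ solve 1 (λ a → a :+ (a :+ a) := con (fromℕ 3) :* a) refl (d x) ⟩
          fromℕ 3 * d x                     ∎

-- Running programs on the word RAM

update-elim : ∀ {A : Set} {f : ℕ → A} {x y a} (P : A → Set) → (y ≡ x → P a) → (y ≢ x → P (f y)) → P (update f x a y)
update-elim {x = x} {y} P same other with y ≡ᵇ x in eq
... | true  = same (ℕ.≡ᵇ⇒≡ y x (subst T (sym eq) tt))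
... | false = other (λ y≡x → subst T eq (ℕ.≡⇒≡ᵇ y x y≡x))

update-same : ∀ {A : Set} (f : ℕ → A) x {a} → update f x a x ≡ a
update-same f x {a} = update-elim {f = f} (_≡ a) (λ _ → refl) (λ x≢x → ⊥-elim (x≢x refl))

update-other : ∀ {A : Set} (f : ℕ → A) {x y a} → y ≢ x → update f x a y ≡ f y
update-other f {y = y} y≢x = update-elim {f = f} (_≡ f y) (λ y≡x → ⊥-elim (y≢x y≡x)) (λ _ → refl)

fromList-lookup : ∀ {A : Set} (f : A → ℕ) xs i → fromList (map f xs) (toℕ i) ≡ f (List.lookup xs i)
fromList-lookup f (x ∷ xs) Fin.zero    = refl
fromList-lookup f (x ∷ xs) (Fin.suc i) = fromList-lookup f xs i

-- Its recursion is that of a loop: the argument counts up while the number of remaining rounds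
-- counts down.
sumFrom : (ℕ → ℕ) → ℕ → ℕ → ℕ
sumFrom f j zero    = 0
sumFrom f j (suc r) = f j ℕ.+ sumFrom f (suc j) r

sumFrom-affine : ∀ a b f j r → sumFrom (λ j → a ℕ.+ b ℕ.* f j) j r ≡ r ℕ.* a ℕ.+ b ℕ.* sumFrom f j r
sumFrom-affine a b f j zero    = sym (ℕ.*-zeroʳ b)
sumFrom-affine a b f j (suc r) = trans (cong (a ℕ.+ b ℕ.* f j ℕ.+_) (sumFrom-affine a b f (suc j) r))
  (solveℕ 5 (λ a b x r s → a +′ b ×′ x +′ (r ×′ a +′ b ×′ s) =′ a +′ r ×′ a +′ b ×′ (x +′ s)) refl a b (f j) r (sumFrom f (suc j) r))

sumFrom-const : ∀ a j r → sumFrom (λ _ → a) j r ≡ r ℕ.* a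
sumFrom-const a j zero    = refl
sumFrom-const a j (suc r) = cong (a ℕ.+_) (sumFrom-const a (suc j) r)

sumFrom-zero : ∀ j r → sumFrom (λ _ → 0) j r ≡ 0
sumFrom-zero j r = trans (sumFrom-const 0 j r) (ℕ.*-zeroʳ r)

sumFrom-cong : ∀ {f g : ℕ → ℕ} → (∀ j → f j ≡ g j) → ∀ j r → sumFrom f j r ≡ sumFrom g j r
sumFrom-cong h j zero    = refl
sumFrom-cong h j (suc r) = cong₂ ℕ._+_ (h j) (sumFrom-cong h (suc j) r)

-- An inequality, since k may lie outside the range of summation. It serves to update `total` when
-- an edge enters a bucket.
sumFrom-bump : ∀ {f g : ℕ → ℕ} {k} → (∀ j → j ≢ k → f j ≡ g j) → f k ≡ suc (g k) →
               ∀ j r → sumFrom f j r ℕ.≤ suc (sumFrom g j r)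
sumFrom-bump {f} {g} {k} off on j zero    = z≤n
sumFrom-bump {f} {g} {k} off on j (suc r) with j ℕ.≟ k
... | yes refl = ℕ.≤-reflexive (cong₂ ℕ._+_ on (beyond (suc j) r ℕ.≤-refl))
  where
  beyond : ∀ j′ r → j ℕ.< j′ → sumFrom f j′ r ≡ sumFrom g j′ r
  beyond j′ zero    _  = refl
  beyond j′ (suc r) lt = cong₂ ℕ._+_ (off j′ (λ eq → ℕ.<-irrefl (sym eq) lt)) (beyond (suc j′) r (ℕ.m<n⇒m<1+n lt))
... | no j≢k = ℕ.≤-trans (ℕ.+-mono-≤ (ℕ.≤-reflexive (off j j≢k)) (sumFrom-bump off on (suc j) r)) (ℕ.≤-reflexive (ℕ.+-suc (g j) _))

-- A total-correctness Hoare triple at a single initial state. The exact time is hidden behind an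
-- upper bound, so that branches of different lengths fit one specification.
Run : ℕ → Program → State → ℕ → (State → Set) → Set
Run W P s c Q = ∃ λ s′ → ∃ λ t → (W ⊢ P , s ⇓ s′ ⟨ t ⟩) × t ℕ.≤ c × Q s′

module _ {W : ℕ} where

  done : ∀ {P s s′ t Q} → W ⊢ P , s ⇓ s′ ⟨ t ⟩ → Q s′ → Run W P s t Q
  done D q = _ , _ , D , ℕ.≤-refl , q

  infixr 5 _then_
  _then_ : ∀ {P P′ s c c′ R Q} → Run W P s c R → (∀ {s′} → R s′ → Run W P′ s′ c′ Q) → Run W (P ⨾ P′) s (c ℕ.+ c′) Q
  (_ , _ , D , t≤ , r) then k = let _ , _ , D′ , t′≤ , q = k r in _ , _ , D ⨾ D′ , ℕ.+-mono-≤ t≤ t′≤ , q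

  within : ∀ {P s c c′ Q} → c ℕ.≤ c′ → Run W P s c Q → Run W P s c′ Q
  within c≤ (_ , _ , D , t≤ , q) = _ , _ , D , ℕ.≤-trans t≤ c≤ , q

  to : ∀ {e s v v′} → v ≡ v′ → W ⊢ e , s ↓ v → W ⊢ e , s ↓ v′
  to refl D = D

  if-positive : ∀ {e P P′ s v c Q} → W ⊢ e , s ↓ v → v ≢ 0 → Run W P s c Q → Run W (ifnz e P P′) s (suc (cost e ℕ.+ c)) Q
  if-positive {v = zero}  De v≢0 _ = ⊥-elim (v≢0 refl)
  if-positive {e} {v = suc _} De _ (_ , _ , D , t≤ , q) = _ , _ , if-nonzero De D , s≤s (ℕ.+-monoʳ-≤ (cost e) t≤) , q

  if-null : ∀ {e P P′ s v c Q} → W ⊢ e , s ↓ v → v ≡ 0 → Run W P′ s c Q → Run W (ifnz e P P′) s (suc (cost e ℕ.+ c)) Q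
  if-null {e} De refl (_ , _ , D , t≤ , q) = _ , _ , if-zero De D , s≤s (ℕ.+-monoʳ-≤ (cost e) t≤) , q

  -- A test of the guard takes 3 steps and the `while` one more, which gives 4 per round and 4 for
  -- the final test. Advancing the counter x is left to the body, and I has to record its value.
  for-loop : ∀ {x y body N} (I : ℕ → State → Set) (c : ℕ → ℕ) → N ℕ.< W →
    (∀ {j s} → I j s → regs s x ≡ j × regs s y ≡ N) →
    (∀ (i : Fin N) {s} → I (toℕ i) s → Run W body s (c (toℕ i)) (I (suc (toℕ i)))) →
    ∀ {s} → I 0 s → Run W (while (op sub (reg y) (reg x)) body) s (4 ℕ.+ sumFrom (λ j → 4 ℕ.+ c j) 0 N) (I N)
  for-loop {x} {y} {body} {N} I c N<W ctr step = go N 0 refl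
    where
    guard : ∀ {j s} → I j s → W ⊢ op sub (reg y) (reg x) , s ↓ (N ℕ.∸ j)
    guard {j} {s} i = let x≡j , y≡N = ctr i in to (cong₂ ℕ._∸_ y≡N x≡j)
      (op reg reg (ℕ.≤-<-trans (ℕ.m∸n≤m _ (regs s x)) (subst (ℕ._< W) (sym y≡N) N<W)))
    below : ∀ {j r} → j ℕ.+ suc r ≡ N → j ℕ.< N
    below {j} eq = subst (j ℕ.<_) eq (ℕ.m<m+n j (s≤s z≤n))
    go : ∀ r j → j ℕ.+ r ≡ N → ∀ {s} → I j s →
         Run W (while (op sub (reg y) (reg x)) body) s (4 ℕ.+ sumFrom (λ j → 4 ℕ.+ c j) j r) (I N)
    go zero j eq i = _ , _ , while-zero (to (trans (cong (ℕ._∸ j) (sym j≡N)) (ℕ.n∸n≡0 j)) (guard i)) , ℕ.≤-refl , subst (λ k → I k _) j≡N i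
      where j≡N = trans (sym (ℕ.+-identityʳ j)) eq
    go (suc r) j eq {s} i
      with _ , t , D , t≤ , i′ ← subst (λ k → I k s → Run W body s (c k) (I (suc k))) (Fin.toℕ-fromℕ< (below eq)) (step (fromℕ< (below eq))) i
      with _ , t′ , D′ , t′≤ , q ← go r (suc j) (trans (sym (ℕ.+-suc j r)) eq) i′
      = _ , _ , while-nonzero (to (trans (cong (ℕ._∸ j) (sym eq)) (ℕ.m+n∸m≡n j (suc r))) (guard i)) D D′ , bound , q
      where
      bound : suc (3 ℕ.+ t ℕ.+ t′) ℕ.≤ 4 ℕ.+ (4 ℕ.+ c j ℕ.+ sumFrom (λ j → 4 ℕ.+ c j) (suc j) r)
      bound = ℕ.≤-trans (ℕ.+-monoʳ-≤ 4 (ℕ.+-mono-≤ t≤ t′≤)) (ℕ.≤-reflexive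
        (solveℕ 2 (λ a b → con′ 4 +′ (a +′ (con′ 4 +′ b)) =′ con′ 4 +′ (con′ 4 +′ a +′ b)) refl (c j) (sumFrom (λ j → 4 ℕ.+ c j) (suc j) r)))

-- Arrays: 2 labels, 3 degrees, 4 loads; 5 holds for every key the head of the
-- linked list of the edges with that key, and 6 the successor of an edge.  The
-- edge with index i is represented there by i + 1, as 0 ends a list.  During the
-- scan register 3 holds the current edge, 4 the prospective leaf and 5 its centre.
increment : ℕ → Program
increment x = set x (op add (reg x) (lit 1))

initLabels : Program
initLabels = while (op sub (reg 0) (reg 2)) (write 2 (reg 2) (reg 2) ⨾ increment 2)

bump : Expr → Program
bump e = write 3 e (op add (read 3 e) (lit 1))

countDegrees : Program
countDegrees = set 2 (lit 0) ⨾ while (op sub (reg 1) (reg 2))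
  ((bump (read 0 (reg 2)) ⨾ bump (read 1 (reg 2))) ⨾ increment 2)

fillBuckets : Program
fillBuckets = set 2 (lit 0) ⨾ while (op sub (reg 1) (reg 2))
  ( set 4 (op add (read 3 (read 0 (reg 2))) (read 3 (read 1 (reg 2))))
  ⨾ set 5 (op add (reg 2) (lit 1))
  ⨾ write 6 (reg 5) (read 5 (reg 4))
  ⨾ write 5 (reg 4) (reg 5)
  ⨾ increment 2)

endpoint : ℕ → Expr
endpoint a = read a (op sub (reg 3) (lit 1))

-- Truncated subtraction serves as the comparison: the guard is nonzero exactly if the first
-- endpoint has the larger degree.
orient : Program
orient = set 4 (endpoint 0) ⨾ set 5 (endpoint 1) ⨾
  ifnz (op sub (read 3 (reg 4)) (read 3 (reg 5))) (set 4 (endpoint 1) ⨾ set 5 (endpoint 0)) skip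

joinStar : Program
joinStar = write 2 (reg 4) (reg 5) ⨾ write 4 (reg 4) (read 3 (reg 4)) ⨾
  write 4 (reg 5) (op add (read 4 (reg 5)) (read 3 (reg 4)))

tryJoin : Program
tryJoin = ifnz (read 4 (reg 4)) skip
  (ifnz (op sub (read 3 (reg 5)) (read 4 (reg 5))) joinStar skip)

scanBucket : Program
scanBucket = while (reg 3) ((orient ⨾ tryJoin) ⨾ set 3 (read 6 (reg 3)))

-- Register 6 holds 2m + 1, the number of possible keys, as a key is a sum of two degrees.
greedy : Program
greedy = set 2 (lit 0) ⨾ set 6 (op add (lit 1) (op add (reg 1) (reg 1))) ⨾
  while (op sub (reg 6) (reg 2)) (set 3 (read 5 (reg 2)) ⨾ scanBucket ⨾ increment 2)

starClustering : Program
starClustering = initLabels ⨾ countDegrees ⨾ fillBuckets ⨾ greedy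

-- Correctness and running time of the program

module Correctness (G : Graph) (0<deg : Graph.NoIsolatedVertices G) (W : ℕ)
                   (big : 4 ℕ.* (1 ℕ.+ Graph.order G ℕ.+ Graph.∣E∣ G) ℕ.≤ W) where
  open Graph G
  open GraphSums G using (ends-distinct)
  open Stars G 0<deg
  open Cell

  n m : ℕ
  n = order
  m = ∣E∣

  edge : Fin m → Vertex × Vertex
  edge = List.lookup edges

  key : Fin m → ℕ
  key i = deg (proj₁ (edge i)) ℕ.+ deg (proj₂ (edge i))

  -- A generous common bound: the indices, degrees, loads and keys that occur are all at most n or
  -- 2m + 1.
  fits : ∀ {k} → k ℕ.≤ 3 ℕ.+ 4 ℕ.* (n ℕ.+ m) → k ℕ.< W
  fits k≤ = ℕ.≤-trans (s≤s k≤) (ℕ.≤-trans (ℕ.≤-reflexive (sym (ℕ.*-distribˡ-+ 4 1 (n ℕ.+ m)))) big)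

  m≤4[n+m] : ∀ {k} → k ℕ.≤ m ℕ.+ m ℕ.+ (m ℕ.+ m) → k ℕ.≤ 4 ℕ.* (n ℕ.+ m)
  m≤4[n+m] k≤ = ℕ.≤-trans k≤ (ℕ.≤-trans (ℕ.≤-reflexive (solveℕ 1 (λ m → m +′ m +′ (m +′ m) =′ con′ 4 ×′ m) refl m)) (ℕ.*-monoʳ-≤ 4 (ℕ.m≤n+m m n)))

  fits-m : ∀ c {k} → c ℕ.≤ 3 → k ℕ.≤ m ℕ.+ m ℕ.+ (m ℕ.+ m) → c ℕ.+ k ℕ.< W
  fits-m c c≤3 k≤ = fits (ℕ.+-mono-≤ c≤3 (m≤4[n+m] k≤))

  fits-m′ : ∀ c {k} → c ℕ.≤ 3 → k ℕ.≤ m ℕ.+ m ℕ.+ (m ℕ.+ m) → k ℕ.+ c ℕ.< W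
  fits-m′ c {k} c≤3 k≤ = subst (ℕ._< W) (ℕ.+-comm c k) (fits-m c c≤3 k≤)

  0<W : 0 ℕ.< W
  0<W = fits z≤n

  1<W : 1 ℕ.< W
  1<W = fits (s≤s z≤n)

  n<W : n ℕ.< W
  n<W = fits (ℕ.≤-trans (ℕ.m≤m+n n m) (ℕ.≤-trans (ℕ.m≤n*m (n ℕ.+ m) 4) (ℕ.m≤n+m _ 3)))

  m<W : m ℕ.< W
  m<W = fits-m 0 z≤n (ℕ.≤-trans (ℕ.m≤m+n m m) (ℕ.m≤m+n _ _))

  deg≤m : ∀ v → deg v ℕ.≤ m
  deg≤m v = List.length-filter _ edges

  deg+deg≤ : ∀ u v → deg u ℕ.+ deg v ℕ.≤ m ℕ.+ m
  deg+deg≤ u v = ℕ.+-mono-≤ (deg≤m u) (deg≤m v)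

  toℕ-≢ : ∀ {k} {u v : Fin k} → u ≢ v → toℕ u ≢ toℕ v
  toℕ-≢ u≢v eq = u≢v (Fin.toℕ-injective eq)

  record Input (s : State) : Set where
    field
      r0 : regs s 0 ≡ n
      r1 : regs s 1 ≡ m
      a0 : arrays s 0 ≡ arrays (input G) 0
      a1 : arrays s 1 ≡ arrays (input G) 1

    end₀ : ∀ i → arrays s 0 (toℕ i) ≡ toℕ (proj₁ (edge i))
    end₀ i = trans (cong (λ f → f (toℕ i)) a0) (fromList-lookup (toℕ ∘ proj₁) edges i)

    end₁ : ∀ i → arrays s 1 (toℕ i) ≡ toℕ (proj₂ (edge i))
    end₁ i = trans (cong (λ f → f (toℕ i)) a1) (fromList-lookup (toℕ ∘ proj₂) edges i)

  Zero : (ℕ → ℕ) → Set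
  Zero f = ∀ i → f i ≡ 0

  record AfterLabels (j : ℕ) (s : State) : Set where
    field
      inp    : Input s
      r2     : regs s 2 ≡ j
      labels : ∀ i → i ℕ.< j → arrays s 2 i ≡ i
      z3     : Zero (arrays s 3)
      z4     : Zero (arrays s 4)
      z5     : Zero (arrays s 5)

  +1≡suc : ∀ {a b} → a ≡ b → a ℕ.+ 1 ≡ suc b
  +1≡suc {a} refl = ℕ.+-comm a 1

  Fin<W : (i : Fin m) → toℕ i ℕ.+ 1 ℕ.< W
  Fin<W i = fits-m′ 1 (s≤s z≤n) (ℕ.≤-trans (ℕ.<⇒≤ (Fin.toℕ<n i)) (ℕ.≤-trans (ℕ.m≤m+n m m) (ℕ.m≤m+n _ _)))

  -- The 11 steps per round are 4 for the guard and 7 for the body; the other loops are counted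
  -- alike.
  initLabels-run : Run W initLabels (input G) (4 ℕ.+ sumFrom (λ _ → 11) 0 n) (AfterLabels n)
  initLabels-run = for-loop AfterLabels (λ _ → 7) n<W (λ I → AfterLabels.r2 I , Input.r0 (AfterLabels.inp I)) step record
    { inp = record { r0 = refl ; r1 = refl ; a0 = refl ; a1 = refl } ; r2 = refl ; labels = λ _ ()
    ; z3 = λ _ → refl ; z4 = λ _ → refl ; z5 = λ _ → refl }
    where
    step : ∀ (i : Fin n) {s} → AfterLabels (toℕ i) s → Run W (write 2 (reg 2) (reg 2) ⨾ increment 2) s 7 (AfterLabels (suc (toℕ i)))
    step i {s} I = done (write reg reg ⨾ set (to (+1≡suc r2) (op reg (lit 1<W) (subst (λ k → k ℕ.+ 1 ℕ.< W) (sym r2) i+1<W)))) record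
      { inp = record { Input inp } ; r2 = refl ; z3 = z3 ; z4 = z4 ; z5 = z5
      ; labels = λ k k< → update-elim {f = arrays s 2} (_≡ k) sym
          (λ k≢ → labels k (ℕ.≤∧≢⇒< (ℕ.≤-pred k<) (λ eq → k≢ (trans eq (sym r2))))) }
      where
      open AfterLabels I
      i+1<W : toℕ i ℕ.+ 1 ℕ.< W
      i+1<W = subst (ℕ._< W) (ℕ.+-comm 1 (toℕ i)) (ℕ.≤-<-trans (Fin.toℕ<n i) n<W)

  touch? : ∀ v (e : Vertex × Vertex) → Dec (proj₁ e ≡ v ⊎ proj₂ e ≡ v)
  touch? v e = (proj₁ e Fin.≟ v) ⊎-dec (proj₂ e Fin.≟ v)

  touches : Vertex → List (Vertex × Vertex) → List (Vertex × Vertex)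
  touches v = filter (touch? v)

  degUpTo : ℕ → Vertex → ℕ
  degUpTo j v = length (touches v (take j edges))

  degUpTo-suc : ∀ (i : Fin m) v → degUpTo (suc (toℕ i)) v ≡ degUpTo (toℕ i) v ℕ.+ length (touches v (edge i ∷ []))
  degUpTo-suc i v = trans (cong (length ∘ touches v) (List.take-suc edges i))
    (trans (cong length (List.filter-++ (touch? v) (take (toℕ i) edges) (edge i ∷ []))) (List.length-++ (touches v (take (toℕ i) edges))))

  degUpTo-hit : ∀ (i : Fin m) v → proj₁ (edge i) ≡ v ⊎ proj₂ (edge i) ≡ v → degUpTo (suc (toℕ i)) v ≡ degUpTo (toℕ i) v ℕ.+ 1
  degUpTo-hit i v hit = trans (degUpTo-suc i v) (cong (λ es → degUpTo (toℕ i) v ℕ.+ length es) (List.filter-accept (touch? v) {edge i} {[]} hit))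

  degUpTo-miss : ∀ (i : Fin m) v → proj₁ (edge i) ≢ v → proj₂ (edge i) ≢ v → degUpTo (suc (toℕ i)) v ≡ degUpTo (toℕ i) v
  degUpTo-miss i v a b = trans (degUpTo-suc i v) (trans (cong (λ es → degUpTo (toℕ i) v ℕ.+ length es)
    (List.filter-reject (touch? v) {edge i} {[]} λ { (inj₁ p) → a p ; (inj₂ q) → b q })) (ℕ.+-identityʳ _))

  degUpTo≤m : ∀ j v → degUpTo j v ℕ.≤ m
  degUpTo≤m j v = ℕ.≤-trans (List.length-filter (touch? v) (take j edges)) (ℕ.≤-trans (ℕ.≤-reflexive (List.length-take j edges)) (ℕ.m⊓n≤n j m))

  degUpTo-all : ∀ v → degUpTo m v ≡ deg v
  degUpTo-all v = cong (length ∘ touches v) (List.take-all m edges ℕ.≤-refl)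

  record AfterDegrees (j : ℕ) (s : State) : Set where
    field
      inp     : Input s
      r2      : regs s 2 ≡ j
      labels  : ∀ (v : Vertex) → arrays s 2 (toℕ v) ≡ toℕ v
      degrees : ∀ v → arrays s 3 (toℕ v) ≡ degUpTo j v
      z4      : Zero (arrays s 4)
      z5      : Zero (arrays s 5)

  countDegrees-run : ∀ {s} → AfterLabels n s → Run W countDegrees s (2 ℕ.+ (4 ℕ.+ sumFrom (λ _ → 24) 0 m)) (AfterDegrees m)
  countDegrees-run {s} I₀ = done {Q = AfterDegrees 0} (set (lit 0<W)) start′ then
    for-loop AfterDegrees (λ _ → 20) m<W (λ I → AfterDegrees.r2 I , Input.r1 (AfterDegrees.inp I)) step
    where
    start′ : AfterDegrees 0 (setReg s 2 0)
    start′ = record { inp = record { Input inp } ; r2 = refl ; labels = λ v → labels (toℕ v) (Fin.toℕ<n v)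
                    ; degrees = λ v → z3 (toℕ v) ; z4 = z4 ; z5 = z5 }
      where open AfterLabels I₀
    step : ∀ (i : Fin m) {s} → AfterDegrees (toℕ i) s →
           Run W ((bump (read 0 (reg 2)) ⨾ bump (read 1 (reg 2))) ⨾ increment 2) s 20 (AfterDegrees (suc (toℕ i)))
    step i {s} I = done
      ( (write (to u≡ (read reg)) (op (to (degrees u) (read (to u≡ (read reg)))) (lit 1<W) (small u))
      ⨾  write (to v≡ (read reg)) (op (to at-v (read (to v≡ (read reg)))) (lit 1<W) (small v)))
      ⨾  set (to (+1≡suc r2) (op reg (lit 1<W) (subst (λ k → k ℕ.+ 1 ℕ.< W) (sym r2) (Fin<W i))))) record
      { inp = record { Input inp } ; r2 = refl ; labels = labels ; degrees = degrees′ ; z4 = z4 ; z5 = z5 }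
      where
      open AfterDegrees I
      u = proj₁ (edge i)
      v = proj₂ (edge i)
      u≢v : u ≢ v
      u≢v = ends-distinct (∈-lookup i)
      u≡ : arrays s 0 (regs s 2) ≡ toℕ u
      u≡ = trans (cong (arrays s 0) r2) (Input.end₀ inp i)
      v≡ : arrays s 1 (regs s 2) ≡ toℕ v
      v≡ = trans (cong (arrays s 1) r2) (Input.end₁ inp i)
      -- The second increment reads an array already changed by the first; u ≢ v keeps the entry of
      -- v intact.
      at-v : update (arrays s 3) (toℕ u) (degUpTo (toℕ i) u ℕ.+ 1) (toℕ v) ≡ degUpTo (toℕ i) v
      at-v = trans (update-other (arrays s 3) (toℕ-≢ (u≢v ∘ sym))) (degrees v)
      small : ∀ w → degUpTo (toℕ i) w ℕ.+ 1 ℕ.< W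
      small w = fits-m′ 1 (s≤s z≤n) (ℕ.≤-trans (degUpTo≤m (toℕ i) w) (ℕ.≤-trans (ℕ.m≤m+n m m) (ℕ.m≤m+n _ _)))
      degrees₁ : ℕ → ℕ
      degrees₁ = update (arrays s 3) (toℕ u) (degUpTo (toℕ i) u ℕ.+ 1)
      degrees′ : ∀ w → update degrees₁ (toℕ v) (degUpTo (toℕ i) v ℕ.+ 1) (toℕ w)
                       ≡ degUpTo (suc (toℕ i)) w
      degrees′ w with u Fin.≟ w | v Fin.≟ w
      ... | _        | yes refl = trans (update-same degrees₁ (toℕ v)) (sym (degUpTo-hit i v (inj₂ refl)))
      ... | yes refl | no v≢w   = trans (update-other degrees₁ (toℕ-≢ u≢v)) (trans (update-same (arrays s 3) (toℕ u)) (sym (degUpTo-hit i u (inj₁ refl))))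
      ... | no u≢w   | no v≢w   = trans (update-other degrees₁ (toℕ-≢ (v≢w ∘ sym))) (trans (update-other (arrays s 3) (toℕ-≢ (u≢w ∘ sym)))
                                    (trans (degrees w) (sym (degUpTo-miss i w u≢w v≢w))))

  -- Ties a linked list in memory to a finite list of edges, which excludes cycles; the traversal is
  -- proved by recursion on that list.
  data Chain (next : ℕ → ℕ) : ℕ → List (Fin m) → Set where
    nil  : Chain next 0 []
    cons : ∀ {i is} → Chain next (next (suc (toℕ i))) is → Chain next (suc (toℕ i)) (i ∷ is)

  -- All members precede x, so the chain never reads the cell of x. This is why edges can be
  -- prepended in the order of their indices.
  Chain-update : ∀ {next h is x a} → All (λ i → toℕ i ℕ.< x) is → Chain next h is → Chain (update next (suc x) a) h is
  Chain-update []         nil      = nil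
  Chain-update {next} (i<x ∷ is<x) (cons c) = cons (subst (λ h → Chain _ h _)
    (sym (update-other next (λ eq → ℕ.<-irrefl (ℕ.suc-injective eq) i<x))) (Chain-update is<x c))

  Buckets : Set
  Buckets = ℕ → List (Fin m)

  -- `seen` protects the chains from later writes, `keyed` provides the K of the invariant during a
  -- scan, `present` guarantees that every edge is treated, and `total` makes all scans together
  -- linear.
  record AfterBuckets (j : ℕ) (s : State) : Set where
    field
      inp     : Input s
      r2      : regs s 2 ≡ j
      labels  : ∀ (v : Vertex) → arrays s 2 (toℕ v) ≡ toℕ v
      degrees : ∀ v → arrays s 3 (toℕ v) ≡ deg v
      z4      : Zero (arrays s 4)
      L       : Buckets
      chain   : ∀ k → Chain (arrays s 6) (arrays s 5 k) (L k)
      seen    : ∀ k → All (λ i → toℕ i ℕ.< j) (L k)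
      keyed   : ∀ k → All (λ i → key i ≡ k) (L k)
      present : ∀ i → toℕ i ℕ.< j → i ∈ₗ L (key i)
      total   : ∀ N → sumFrom (length ∘ L) 0 N ℕ.≤ j

  fillBuckets-run : ∀ {s} → AfterDegrees m s → Run W fillBuckets s (2 ℕ.+ (4 ℕ.+ sumFrom (λ _ → 27) 0 m)) (AfterBuckets m)
  fillBuckets-run {s} I₀ = done {Q = AfterBuckets 0} (set (lit 0<W)) start′ then
    for-loop AfterBuckets (λ _ → 23) m<W (λ I → AfterBuckets.r2 I , Input.r1 (AfterBuckets.inp I)) step
    where
    start′ : AfterBuckets 0 (setReg s 2 0)
    start′ = record { inp = record { Input inp } ; r2 = refl ; labels = labels
                    ; degrees = λ v → trans (degrees v) (degUpTo-all v) ; z4 = z4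
                    ; L = λ _ → [] ; chain = λ k → subst (λ h → Chain (arrays s 6) h []) (sym (z5 k)) nil
                    ; seen = λ _ → [] ; keyed = λ _ → [] ; present = λ _ () ; total = λ N → ℕ.≤-reflexive (sumFrom-zero 0 N) }
      where open AfterDegrees I₀
    step : ∀ (i : Fin m) {s} → AfterBuckets (toℕ i) s → Run W
      ( set 4 (op add (read 3 (read 0 (reg 2))) (read 3 (read 1 (reg 2))))
      ⨾ set 5 (op add (reg 2) (lit 1))
      ⨾ write 6 (reg 5) (read 5 (reg 4))
      ⨾ write 5 (reg 4) (reg 5)
      ⨾ increment 2) s 23 (AfterBuckets (suc (toℕ i)))
    step i {s} I = done
      ( set (op (to (degrees u) (read (to u≡ (read reg)))) (to (degrees v) (read (to v≡ (read reg)))) key<W)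
      ⨾ set (to (+1≡suc r2) (op reg (lit 1<W) (subst (λ k → k ℕ.+ 1 ℕ.< W) (sym r2) (Fin<W i))))
      ⨾ write reg (read reg)
      ⨾ write reg reg
      ⨾ set (to (+1≡suc r2) (op reg (lit 1<W) (subst (λ k → k ℕ.+ 1 ℕ.< W) (sym r2) (Fin<W i))))) record
      { inp = record { Input inp } ; r2 = refl ; labels = labels ; degrees = degrees ; z4 = z4
      ; L = L′
      ; chain = λ k → chain′ k (k ℕ.≟ key i)
      ; seen = λ k → update-elim {f = L} (All (λ i′ → toℕ i′ ℕ.< suc (toℕ i)))
          (λ _ → ℕ.≤-refl ∷ All.map ℕ.m<n⇒m<1+n (seen (key i))) (λ _ → All.map ℕ.m<n⇒m<1+n (seen k))
      ; keyed = λ k → update-elim {f = L} (All (λ i → key i ≡ k)) (λ { refl → refl ∷ keyed (key i) }) (λ _ → keyed k)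
      ; present = present′
      ; total = λ N → ℕ.≤-trans (sumFrom-bump {length ∘ L′} {length ∘ L} {key i}
          (λ j j≢ → cong length (update-other L j≢)) (cong length (update-same L (key i) {i ∷ L (key i)})) 0 N) (s≤s (total N)) }
      where
      open AfterBuckets I
      u = proj₁ (edge i)
      v = proj₂ (edge i)
      u≡ : arrays s 0 (regs s 2) ≡ toℕ u
      u≡ = trans (cong (arrays s 0) r2) (Input.end₀ inp i)
      v≡ : arrays s 1 (regs s 2) ≡ toℕ v
      v≡ = trans (cong (arrays s 1) r2) (Input.end₁ inp i)
      key<W : key i ℕ.< W
      key<W = fits-m 0 z≤n (ℕ.≤-trans (deg+deg≤ u v) (ℕ.m≤m+n _ _))
      L′ : Buckets
      L′ = update L (key i) (i ∷ L (key i))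
      next′ : ℕ → ℕ
      next′ = update (arrays s 6) (suc (toℕ i)) (arrays s 5 (key i))
      chain′ : ∀ k → Dec (k ≡ key i) → Chain next′ (update (arrays s 5) (key i) (suc (toℕ i)) k) (L′ k)
      chain′ k (yes refl) = subst₂ (Chain next′) (sym (update-same (arrays s 5) (key i))) (sym (update-same L (key i)))
        (cons (subst (λ h → Chain next′ h (L (key i))) (sym (update-same (arrays s 6) (suc (toℕ i)))) (Chain-update (seen (key i)) (chain (key i)))))
      chain′ k (no k≢)    = subst₂ (Chain next′) (sym (update-other (arrays s 5) k≢)) (sym (update-other L k≢))
        (Chain-update (seen k) (chain k))
      present′ : ∀ i′ → toℕ i′ ℕ.< suc (toℕ i) → i′ ∈ₗ L′ (key i′)
      present′ i′ i′< with i′ Fin.≟ i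
      ... | yes refl = subst (i ∈ₗ_) (sym (update-same L (key i))) (here refl)
      ... | no i′≢i  = update-elim {f = L} (i′ ∈ₗ_) (λ eq → there (subst (λ k → i′ ∈ₗ L k) eq old)) (λ _ → old)
        where old = present i′ (ℕ.≤∧≢⇒< (ℕ.≤-pred i′<) (toℕ-≢ i′≢i))

  -- Payments are never withdrawn, so an edge once paid for stays so until the end.
  Priced-mono : ∀ (S S′ : Cells) → (∀ w → y (S w) ≤ y (S′ w)) → ∀ {u v} → Priced S u v → Priced S′ u v
  Priced-mono S S′ grows {u} {v} p = ≤-trans p (ℚ.+-mono-≤ (*-monoˡ (0≤d v) (grows u)) (*-monoˡ (0≤d u) (grows v)))

  PricedEdge : Cells → Fin m → Set
  PricedEdge S i = Priced S (proj₁ (edge i)) (proj₂ (edge i))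

  lastKey : ℕ
  lastKey = m ℕ.+ m

  module _ (head next : ℕ → ℕ) where

    -- Only `lab` and `load` of a cell are stored in memory; `num` and `y` are ghost variables of
    -- the proof. Arrays 5 and 6 are frozen at `head` and `next` from here on.
    record Scan (κ : ℕ) (S : Cells) (s : State) : Set where
      field
        inp     : Input s
        r2      : regs s 2 ≡ κ
        r6      : regs s 6 ≡ suc lastKey
        degrees : ∀ v → arrays s 3 (toℕ v) ≡ deg v
        a5      : arrays s 5 ≡ head
        a6      : arrays s 6 ≡ next
        labels  : ∀ v → arrays s 2 (toℕ v) ≡ toℕ (lab (S v))
        loads   : ∀ v → arrays s 4 (toℕ v) ≡ load (S v)

    record Oriented (κ : ℕ) (S : Cells) (i : Fin m) (s : State) : Set where
      field
        scan    : Scan κ S s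
        r3      : regs s 3 ≡ suc (toℕ i)
        u v     : Vertex
        r4      : regs s 4 ≡ toℕ u
        r5      : regs s 5 ≡ toℕ v
        ends    : edge i ≡ (u , v) ⊎ edge i ≡ (v , u)
        du≤dv   : deg u ℕ.≤ deg v

    endpoint₀ : ∀ {κ S i s} → Scan κ S s → regs s 3 ≡ suc (toℕ i) → W ⊢ endpoint 0 , s ↓ toℕ (proj₁ (edge i))
    endpoint₁ : ∀ {κ S i s} → Scan κ S s → regs s 3 ≡ suc (toℕ i) → W ⊢ endpoint 1 , s ↓ toℕ (proj₂ (edge i))
    index     : ∀ {i s} → regs s 3 ≡ suc (toℕ i) → W ⊢ op sub (reg 3) (lit 1) , s ↓ toℕ i
    index {i} r3 = to (cong (ℕ._∸ 1) r3) (op reg (lit 1<W) (subst (λ k → k ℕ.∸ 1 ℕ.< W) (sym r3) (ℕ.<-trans (Fin.toℕ<n i) m<W)))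
    endpoint₀ {i = i} sc r3 = to (Input.end₀ (Scan.inp sc) i) (read (index r3))
    endpoint₁ {i = i} sc r3 = to (Input.end₁ (Scan.inp sc) i) (read (index r3))

    orient-run : ∀ {κ S i s} → Scan κ S s → regs s 3 ≡ suc (toℕ i) → Run W orient s 26 (Oriented κ S i)
    orient-run {κ} {S} {i} {s} sc r3 =
      done {Q = _≡ s₁} (set (endpoint₀ sc r3)) refl then λ { refl →
      done {Q = _≡ s₂} (set (endpoint₁ sc₁ r3)) refl then λ { refl → branch (deg a ℕ.≤? deg b) } }
      where
      a = proj₁ (edge i)
      b = proj₂ (edge i)
      s₁ = setReg s 4 (toℕ a)
      s₂ = setReg s₁ 5 (toℕ b)
      sc₁ : Scan κ S s₁
      sc₁ = record { Scan sc ; inp = record { Input (Scan.inp sc) } }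
      sc₂ : Scan κ S s₂
      sc₂ = record { Scan sc ; inp = record { Input (Scan.inp sc) } }
      sc₃ : Scan κ S (setReg s₂ 4 (toℕ b))
      sc₃ = record { Scan sc ; inp = record { Input (Scan.inp sc) } }
      guard : W ⊢ op sub (read 3 (reg 4)) (read 3 (reg 5)) , s₂ ↓ deg a ℕ.∸ deg b
      guard = op (to (Scan.degrees sc a) (read reg)) (to (Scan.degrees sc b) (read reg))
        (ℕ.≤-<-trans (ℕ.≤-trans (ℕ.m∸n≤m (deg a) (deg b)) (deg≤m a)) m<W)
      branch : Dec (deg a ℕ.≤ deg b) → Run W
        (ifnz (op sub (read 3 (reg 4)) (read 3 (reg 5))) (set 4 (endpoint 1) ⨾ set 5 (endpoint 0)) skip) s₂ 16 (Oriented κ S i)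
      branch (yes le) = within (ℕ.m≤m+n 7 9) (if-null guard (ℕ.m≤n⇒m∸n≡0 le) (done skip record
        { scan = sc₂ ; r3 = r3 ; u = a ; v = b ; r4 = refl ; r5 = refl ; ends = inj₁ refl ; du≤dv = le }))
      branch (no ¬le) = if-positive guard (ℕ.m>n⇒m∸n≢0 (ℕ.≰⇒> ¬le))
        (done (set (endpoint₁ sc₂ r3) ⨾ set (endpoint₀ sc₃ r3)) record
          { scan = record { Scan sc ; inp = record { Input (Scan.inp sc) } } ; r3 = r3
          ; u = b ; v = a ; r4 = refl ; r5 = refl ; ends = inj₂ refl ; du≤dv = ℕ.<⇒≤ (ℕ.≰⇒> ¬le) })

    record Settled (κ : ℕ) (S : Cells) (i : Fin m) (s : State) : Set where
      field
        S′     : Cells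
        scan   : Scan κ S′ s
        r3     : regs s 3 ≡ suc (toℕ i)
        inv    : Inv κ S′
        grows  : ∀ w → y (S w) ≤ y (S′ w)
        priced : PricedEdge S′ i

    -- Each of the three outcomes leaves the edge paid for: `skip-used` if u is taken, `skip-full`
    -- if v accepts no leaf, `join-priced` otherwise.
    tryJoin-run : ∀ {S i s} → Inv (key i) S → Oriented (key i) S i s → Run W tryJoin s 23 (Settled (key i) S i)
    tryJoin-run {S} {i} {s} I o = branch (load (S u) ℕ.≟ 0) (load (S v) ℕ.<? deg v)
      where
      open Oriented o
      open Scan scan using (inp; degrees; labels; loads)
      κ≡ : deg u ℕ.+ deg v ≡ key i
      κ≡ = endsKey ends
        where
        endsKey : edge i ≡ (u , v) ⊎ edge i ≡ (v , u) → deg u ℕ.+ deg v ≡ key i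
        endsKey (inj₁ eq) = cong (λ e → deg (proj₁ e) ℕ.+ deg (proj₂ e)) (sym eq)
        endsKey (inj₂ eq) = trans (ℕ.+-comm (deg u) (deg v)) (cong (λ e → deg (proj₁ e) ℕ.+ deg (proj₂ e)) (sym eq))
      u≢v : u ≢ v
      u≢v eq = distinct ends
        where
        distinct : edge i ≡ (u , v) ⊎ edge i ≡ (v , u) → _
        distinct (inj₁ e≡) = ends-distinct (∈-lookup i) (trans (cong proj₁ e≡) (trans eq (sym (cong proj₂ e≡))))
        distinct (inj₂ e≡) = ends-distinct (∈-lookup i) (trans (cong proj₁ e≡) (trans (sym eq) (sym (cong proj₂ e≡))))
      pricedEdge : ∀ S → Priced S u v → PricedEdge S i
      pricedEdge S p = go ends
        where
        go : edge i ≡ (u , v) ⊎ edge i ≡ (v , u) → PricedEdge S i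
        go (inj₁ e≡) = subst (λ e → Priced S (proj₁ e) (proj₂ e)) (sym e≡) p
        go (inj₂ e≡) = subst (λ e → Priced S (proj₁ e) (proj₂ e)) (sym e≡) (Priced-sym {S} {u} {v} p)
      I′ : Inv (deg u ℕ.+ deg v) S
      I′ = subst (λ κ → Inv κ S) (sym κ≡) I
      loadOf : ∀ {r w} → regs s r ≡ toℕ w → W ⊢ read 4 (reg r) , s ↓ load (S w)
      loadOf {w = w} r≡ = to (trans (cong (arrays s 4) r≡) (loads w)) (read reg)
      degOf : ∀ {r w} → regs s r ≡ toℕ w → W ⊢ read 3 (reg r) , s ↓ deg w
      degOf {w = w} r≡ = to (trans (cong (arrays s 3) r≡) (degrees w)) (read reg)
      unchanged : Priced S u v → Settled (key i) S i s
      unchanged p = record { S′ = S ; scan = scan ; r3 = r3 ; inv = I ; grows = λ _ → ℚ.≤-refl ; priced = pricedEdge S p }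
      guard : W ⊢ op sub (read 3 (reg 5)) (read 4 (reg 5)) , s ↓ deg v ℕ.∸ load (S v)
      guard = op (degOf r5) (loadOf r5) (ℕ.≤-<-trans (ℕ.≤-trans (ℕ.m∸n≤m (deg v) (load (S v))) (deg≤m v)) m<W)
      joinNow : load (S u) ≡ 0 → load (S v) ℕ.< deg v → Run W joinStar s 14 (Settled (key i) S i)
      joinNow u≡0 v-free = done
        (write (to r4 reg) (to r5 reg) ⨾ write (to r4 reg) (to (trans (cong (arrays s 3) r4) (degrees u)) (read reg)) ⨾
         write (to r5 reg) (op (to load-v (read (to r5 reg))) (to (trans (cong (arrays s 3) r4) (degrees u)) (read reg)) small)) record
        { S′     = join I′ du≤dv
        ; scan   = record { Scan scan ; inp = record { Input inp }
                          ; labels = λ w → proj₁ (cells w) ; loads = λ w → proj₂ (cells w) }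
        ; r3     = r3
        ; inv    = subst (λ κ → Inv κ (join I′ du≤dv)) κ≡ (join-inv I′ du≤dv u≢v u≡0 v-free (∈-lookup i) ends)
        ; grows  = y-join I′ du≤dv u≢v u≡0 v-free
        ; priced = pricedEdge (join I′ du≤dv) (join-priced I′ du≤dv u≢v u≡0 v-free)
        }
        where
        load-v : update (arrays s 4) (toℕ u) (deg u) (toℕ v) ≡ load (S v)
        load-v = trans (update-other (arrays s 4) (toℕ-≢ (u≢v ∘ sym))) (loads v)
        small : load (S v) ℕ.+ deg u ℕ.< W
        small = fits-m 0 z≤n (ℕ.≤-trans (ℕ.+-mono-≤ (ℕ.≤-trans (ℕ.<⇒≤ v-free) (deg≤m v)) (deg≤m u)) (ℕ.m≤m+n _ _))
        loads₁ : ℕ → ℕ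
        loads₁ = update (arrays s 4) (toℕ u) (deg u)
        Match : Vertex → Cell Vertex → Set
        Match w c = update (arrays s 2) (toℕ u) (toℕ v) (toℕ w) ≡ toℕ (lab c)
                  × update loads₁ (toℕ v) (load (S v) ℕ.+ deg u) (toℕ w) ≡ load c
        cells : ∀ w → Match w (join I′ du≤dv w)
        cells = join-elim I′ du≤dv u≢v u≡0 v-free Match
          (update-same (arrays s 2) (toℕ u) , trans (update-other loads₁ (toℕ-≢ u≢v)) (update-same (arrays s 4) (toℕ u)))
          (trans (update-other (arrays s 2) (toℕ-≢ (u≢v ∘ sym))) (labels v) , update-same loads₁ (toℕ v))
          (λ w w≢u w≢v → trans (update-other (arrays s 2) (toℕ-≢ w≢u)) (labels w)
                       , trans (update-other loads₁ (toℕ-≢ w≢v)) (trans (update-other (arrays s 4) (toℕ-≢ w≢u)) (loads w)))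
      branch : Dec (load (S u) ≡ 0) → Dec (load (S v) ℕ.< deg v) → Run W tryJoin s 23 (Settled (key i) S i)
      branch (no u≢0)  _           = within (ℕ.m≤m+n 4 19) (if-positive (loadOf r4) u≢0 (done skip (unchanged (skip-used I′ du≤dv u≢0))))
      branch (yes u≡0) (no full)   = within (ℕ.m≤m+n 10 13) (if-null (loadOf r4) u≡0 (if-null guard (ℕ.m≤n⇒m∸n≡0 (ℕ.≮⇒≥ full))
                                       (done skip (unchanged (skip-full I′ du≤dv (ℕ.≮⇒≥ full))))))
      branch (yes u≡0) (yes free)  = if-null (loadOf r4) u≡0 (if-positive guard (ℕ.m>n⇒m∸n≢0 free) (joinNow u≡0 free))

    record Scanned (κ : ℕ) (S : Cells) (is : List (Fin m)) (s : State) : Set where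
      field
        S′     : Cells
        scan   : Scan κ S′ s
        inv    : Inv κ S′
        grows  : ∀ w → y (S w) ≤ y (S′ w)
        priced : All (PricedEdge S′) is

    -- Within a bucket all keys equal κ, so the invariant is kept at the same K. An edge costs 54 =
    -- 2 + 26 + 23 + 3: guard, orientation, attempt to join, step to the successor.
    scanBucket-run : ∀ {κ S h is s} → Scan κ S s → Inv κ S → All (λ i → key i ≡ κ) is → Chain next h is → regs s 3 ≡ h →
                     Run W scanBucket s (2 ℕ.+ length is ℕ.* 54) (Scanned κ S is)
    scanBucket-run sc I [] nil r3 = done (while-zero (to r3 reg)) record
      { S′ = _ ; scan = sc ; inv = I ; grows = λ _ → ℚ.≤-refl ; priced = [] }
    scanBucket-run {κ} {S} {is = i ∷ is} {s} sc I (refl ∷ keyed) (cons c) r3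
      with _ , _ , D , t≤ , st ← orient-run sc r3 then tryJoin-run I
      with _ , _ , D′ , t′≤ , fin ← scanBucket-run {s = setReg _ 3 _}
             (record { Scan (Settled.scan st) ; inp = record { Input (Scan.inp (Settled.scan st)) } }) (Settled.inv st) keyed c refl
      = _ , _ , while-nonzero (to r3 reg) (D ⨾ set (to (cong₂ (λ f k → f k) (Scan.a6 (Settled.scan st)) (Settled.r3 st)) (read reg))) D′
      , ℕ.≤-trans (s≤s (s≤s (ℕ.+-mono-≤ (ℕ.+-monoˡ-≤ 3 t≤) t′≤)))
          (ℕ.≤-reflexive (solveℕ 1 (λ l → con′ 54 +′ (con′ 2 +′ l) =′ con′ 2 +′ (con′ 54 +′ l)) refl (length is ℕ.* 54)))
      , record
        { S′     = Scanned.S′ fin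
        ; scan   = Scanned.scan fin
        ; inv    = Scanned.inv fin
        ; grows  = λ w → ≤-trans (Settled.grows st w) (Scanned.grows fin w)
        ; priced = Priced-mono (Settled.S′ st) (Scanned.S′ fin) (Scanned.grows fin) (Settled.priced st) ∷ Scanned.priced fin
        }

    module _ (L : Buckets) (chain : ∀ k → Chain next (head k) (L k)) (keyed : ∀ k → All (λ i → key i ≡ k) (L k))
             (present : ∀ i → i ∈ₗ L (key i)) where

      record Processed (κ : ℕ) (s : State) : Set where
        field
          S      : Cells
          scan   : Scan κ S s
          inv    : Inv κ S
          priced : ∀ i → key i ℕ.< κ → PricedEdge S i

      bucketCost : ℕ → ℕ
      bucketCost κ = 3 ℕ.+ (2 ℕ.+ length (L κ) ℕ.* 54 ℕ.+ 4)

      suc-lastKey<W : suc lastKey ℕ.< W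
      suc-lastKey<W = fits-m 1 (s≤s z≤n) (ℕ.m≤m+n (m ℕ.+ m) (m ℕ.+ m))

      sweep-run : ∀ {s} → Processed 0 s → Run W (while (op sub (reg 6) (reg 2)) (set 3 (read 5 (reg 2)) ⨾ scanBucket ⨾ increment 2)) s
                  (4 ℕ.+ sumFrom (λ κ → 4 ℕ.+ bucketCost κ) 0 (suc lastKey)) (Processed (suc lastKey))
      sweep-run = for-loop Processed bucketCost suc-lastKey<W
        (λ P → Scan.r2 (Processed.scan P) , Scan.r6 (Processed.scan P)) step
        where
        step : ∀ (k : Fin (suc lastKey)) {s} → Processed (toℕ k) s →
               Run W (set 3 (read 5 (reg 2)) ⨾ scanBucket ⨾ increment 2) s (bucketCost (toℕ k)) (Processed (suc (toℕ k)))
        step k {s} P =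
          done {Q = _≡ setReg s 3 (head κ)} (set (to (cong₂ (λ f k → f k) a5 r2) (read reg))) refl then λ { refl →
          scanBucket-run (record { Scan scan ; inp = record { Input inp } }) inv (keyed κ) (chain κ) refl then λ fin →
          done (set (to (+1≡suc (Scan.r2 (Scanned.scan fin))) (op reg (lit 1<W)
                 (subst (λ k → k ℕ.+ 1 ℕ.< W) (sym (Scan.r2 (Scanned.scan fin))) κ+1<W)))) record
            { S = Scanned.S′ fin
            ; scan = record { Scan (Scanned.scan fin) ; inp = record { Input (Scan.inp (Scanned.scan fin)) } ; r2 = refl }
            -- The ascending order enters here: the K of the invariant can be raised to the next
            -- key.
            ; inv = Inv-mono (ℕ.n≤1+n κ) (Scanned.inv fin)
            ; priced = λ i i≤ → priced′ fin i (key i ℕ.≟ κ) i≤ } }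
          where
          κ = toℕ k
          open Processed P
          open Scan scan
          κ+1<W : κ ℕ.+ 1 ℕ.< W
          κ+1<W = fits-m′ 1 (s≤s z≤n) (ℕ.≤-trans (ℕ.≤-pred (Fin.toℕ<n k)) (ℕ.m≤m+n (m ℕ.+ m) (m ℕ.+ m)))
          priced′ : ∀ {s} (fin : Scanned κ S (L κ) s) i → Dec (key i ≡ κ) → key i ℕ.< suc κ → PricedEdge (Scanned.S′ fin) i
          priced′ fin i (yes eq) _  = All.lookup (Scanned.priced fin) (subst (λ k → i ∈ₗ L k) eq (present i))
          priced′ fin i (no key≢) i≤ = Priced-mono S (Scanned.S′ fin) (Scanned.grows fin) (priced i (ℕ.≤∧≢⇒< (ℕ.≤-pred i≤) key≢))

  record Final (s : State) : Set where
    field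
      S      : Cells
      inv    : ∃ λ κ → Inv κ S
      labels : ∀ v → arrays s 2 (toℕ v) ≡ toℕ (lab (S v))
      priced : ∀ i → PricedEdge S i

  greedyCost : ℕ
  greedyCost = 2 ℕ.+ (6 ℕ.+ (4 ℕ.+ (suc lastKey ℕ.* 13 ℕ.+ 54 ℕ.* m)))

  greedy-run : ∀ {s} → AfterBuckets m s → Run W greedy s greedyCost Final
  greedy-run {s} A = within cost≤
    ( done {Q = _≡ s₁} (set (lit 0<W)) refl then λ { refl →
      done {Q = Processed head next L chain keyed present′ 0} (set (to (cong (λ k → suc (k ℕ.+ k)) r1)
        (op (lit 1<W) (op reg reg (subst (λ k → k ℕ.+ k ℕ.< W) (sym r1) 2m<W))
          (subst (λ k → suc (k ℕ.+ k) ℕ.< W) (sym r1) (suc-lastKey<W head next L chain keyed present′))))) first then λ P →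
      let _ , _ , D , t≤ , P′ = sweep-run head next L chain keyed present′ P in _ , _ , D , t≤ , result P′ })
    where
    open AfterBuckets A
    open Input inp
    s₁ = setReg s 2 0
    head = arrays s 5
    next = arrays s 6
    present′ : ∀ i → i ∈ₗ L (key i)
    present′ i = present i (Fin.toℕ<n i)
    2m<W : m ℕ.+ m ℕ.< W
    2m<W = fits-m 0 z≤n (ℕ.m≤m+n (m ℕ.+ m) (m ℕ.+ m))
    first : Processed head next L chain keyed present′ 0 (setReg s₁ 6 (suc lastKey))
    first = record
      { S = start
      ; scan = record { inp = record { Input inp } ; r2 = refl ; r6 = refl ; degrees = degrees ; a5 = refl ; a6 = refl
                      ; labels = labels ; loads = λ v → z4 (toℕ v) }
      ; inv = start-inv
      ; priced = λ _ () }
    result : ∀ {s} → Processed head next L chain keyed present′ (suc lastKey) s → Final s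
    result P = record { S = S ; inv = _ , inv ; labels = Scan.labels scan
                      -- No key exceeds 2m, so after 2m + 1 buckets no edge is left.
                      ; priced = λ i → priced i (s≤s (deg+deg≤ (proj₁ (edge i)) (proj₂ (edge i)))) }
      where open Processed P
    -- Each of the 2m + 1 buckets has an overhead of 13, even if empty; the cost of the edges is
    -- bounded through `total`, not bucket by bucket.
    cost≤ : 2 ℕ.+ (6 ℕ.+ (4 ℕ.+ sumFrom (λ κ → 4 ℕ.+ bucketCost head next L chain keyed present′ κ) 0 (suc lastKey))) ℕ.≤ greedyCost
    cost≤ = ℕ.+-monoʳ-≤ 12 (ℕ.≤-trans
      (ℕ.≤-reflexive (trans (sumFrom-cong {g = λ κ → 13 ℕ.+ 54 ℕ.* length (L κ)}
          (λ κ → solveℕ 1 (λ l → con′ 4 +′ (con′ 3 +′ (con′ 2 +′ l ×′ con′ 54 +′ con′ 4)) =′ con′ 13 +′ con′ 54 ×′ l) refl (length (L κ))) 0 (suc lastKey))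
        (sumFrom-affine 13 54 (length ∘ L) 0 (suc lastKey))))
      (ℕ.+-monoʳ-≤ (suc lastKey ℕ.* 13) (ℕ.*-monoʳ-≤ 54 (total (suc lastKey)))))

-- From scores to the approximation ratio

halfMass : ℕ → ℚ
halfMass n = (fromℕ n + fromℕ n) * recip (4 ℕ.* n)

-- The doubled quantity is 4n · (1 / 4n), which is 1, or 0 for n = 0.
halfMass≤½ : ∀ n → halfMass n + halfMass n ≤ 1ℚ
halfMass≤½ n = ≤-trans (≤-reflexive (trans
  (solve 2 (λ a r → (a :+ a) :* r :+ (a :+ a) :* r := con (fromℕ 4) :* a :* r) refl (fromℕ n) (recip (4 ℕ.* n)))
  (cong (_* recip (4 ℕ.* n)) (sym (fromℕ-* 4 n))))) (n*recip≤1 (4 ℕ.* n))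
  where
  n*recip≤1 : ∀ n → fromℕ n * recip n ≤ 1ℚ
  n*recip≤1 zero    = 0≤fromℕ 1
  n*recip≤1 (suc n) = ≤-reflexive (recip-inverse {suc n} (s≤s z≤n))

α : ℚ
α = ℤ.+ 1 / 12

-- Here e₀, e and e′ are the scores of the promised clustering, of the stars and of a competitor, c
-- is the common ½ and w is 1 / m. From e₀ ≥ 6 follows 6e ≥ 6 ≥ 12c, so passing from 6e to 12(e - c)
-- absorbs the subtraction.
approximate : ∀ {e₀ e e′ c w} → fromℕ 12 ≤ e₀ + e₀ → e₀ ≤ fromℕ 6 * e → e′ ≤ fromℕ 6 * e → c + c ≤ 1ℚ → 0ℚ ≤ c → 0ℚ ≤ w →
              α * ((e′ - c) * w) ≤ (e - c) * w
approximate {e₀} {e} {e′} {c} {w} 12≤ e₀≤ e′≤ c≤ 0≤c 0≤w = begin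
  α * ((e′ - c) * w)                      ≡⟨ ℚ.*-assoc α (e′ - c) w ⟨
  α * (e′ - c) * w                        ≤⟨ *-monoʳ 0≤w (*-monoˡ (toWitness {a? = 0ℚ ℚ.≤? α} tt) inner) ⟩
  α * (fromℕ 12 * (e - c)) * w            ≡⟨ solve 2 (λ z w → con α :* (con (fromℕ 12) :* z) :* w := z :* w) refl (e - c) w ⟩
  (e - c) * w                             ∎
  where
  open ℚ.≤-Reasoning
  a = fromℕ 6 * e
  6≤a : fromℕ 6 ≤ a
  6≤a = begin
    fromℕ 6           ≤⟨ *-monoˡ (toWitness {a? = 0ℚ ℚ.≤? ½} tt) (≤-trans 12≤ (ℚ.+-mono-≤ e₀≤ e₀≤)) ⟩
    ½ * (a + a)       ≡⟨ solve 1 (λ a → con ½ :* (a :+ a) := a) refl a ⟩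
    a                 ∎
  inner : e′ - c ≤ fromℕ 12 * (e - c)
  inner = begin
    e′ - c                                          ≤⟨ ℚ.+-monoˡ-≤ (- c) e′≤ ⟩
    -- Uses -c ≤ 0 ≤ 6e - 6; the next line then replaces 6 by the smaller 6 · 2c.
    a - c                                           ≤⟨ ℚ.+-monoʳ-≤ a (≤-trans (ℚ.neg-antimono-≤ 0≤c) (ℚ.+-monoˡ-≤ (- fromℕ 6) 6≤a)) ⟩
    a + (a - fromℕ 6)                               ≤⟨ ℚ.+-monoʳ-≤ a (ℚ.+-monoʳ-≤ a (ℚ.neg-antimono-≤ (*-monoˡ (0≤fromℕ 6) c≤))) ⟩
    a + (a - fromℕ 6 * (c + c))                     ≡⟨ solve 2 (λ e c → con (fromℕ 6) :* e :+ (con (fromℕ 6) :* e :- con (fromℕ 6) :* (c :+ c)) := con (fromℕ 12) :* (e :- c)) refl e c ⟩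
    fromℕ 12 * (e - c)                              ∎

module _ (G : Graph) (0<deg : Graph.NoIsolatedVertices G) where
  open Graph G
  open GraphSums G
  open Cell

  -- With x = n + m the slack is x², because (2 + x)² = 4(1 + x) + x²; hence words with κ = 2 are
  -- large enough.
  wordBound-big : 4 ℕ.* (1 ℕ.+ order ℕ.+ ∣E∣) ℕ.≤ wordBound 2 G
  wordBound-big = ℕ.≤-trans (ℕ.m≤m+n _ ((order ℕ.+ ∣E∣) ℕ.* (order ℕ.+ ∣E∣)))
    (ℕ.≤-reflexive (solveℕ 1 (λ x → con′ 4 ×′ (con′ 1 +′ x) +′ x ×′ x =′ (con′ 2 +′ x) ×′ ((con′ 2 +′ x) ×′ con′ 1)) refl (order ℕ.+ ∣E∣)))

  open Correctness G 0<deg (wordBound 2 G) wordBound-big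
  open Stars G 0<deg

  -- The coefficient of m is 24 + 27 + 26 + 54 = 131. The additive constant 41 is absorbed by the
  -- first vertex, which is why the vertex set must not be empty.
  starClustering-run : 0 ℕ.< order → Run (wordBound 2 G) starClustering (input G) (131 ℕ.* (order ℕ.+ ∣E∣)) Final
  starClustering-run 0<n = within cost≤ (initLabels-run then λ A → countDegrees-run A then λ A → fillBuckets-run A then greedy-run)
    where
    linear : ∀ {n} m → 0 ℕ.< n → 4 ℕ.+ n ℕ.* 11 ℕ.+ (6 ℕ.+ m ℕ.* 24 ℕ.+ (6 ℕ.+ m ℕ.* 27 ℕ.+ (12 ℕ.+ (suc (m ℕ.+ m) ℕ.* 13 ℕ.+ 54 ℕ.* m)))) ℕ.≤ 131 ℕ.* (n ℕ.+ m)
    linear {suc n} m _ = ℕ.≤-trans (ℕ.m≤m+n _ (79 ℕ.+ 120 ℕ.* n)) (ℕ.≤-reflexive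
      (solveℕ 2 (λ n m → con′ 4 +′ (con′ 1 +′ n) ×′ con′ 11 +′ (con′ 6 +′ m ×′ con′ 24 +′ (con′ 6 +′ m ×′ con′ 27 +′
          (con′ 12 +′ ((con′ 1 +′ (m +′ m)) ×′ con′ 13 +′ con′ 54 ×′ m)))) +′ (con′ 79 +′ con′ 120 ×′ n)
        =′ con′ 131 ×′ (con′ 1 +′ n +′ m)) refl n m))
    cost≤ : _ ℕ.≤ 131 ℕ.* (order ℕ.+ ∣E∣)
    cost≤ = ℕ.≤-trans (ℕ.≤-reflexive (cong₂ ℕ._+_ (cong (4 ℕ.+_) (sumFrom-const 11 0 order))
      (cong₂ ℕ._+_ (cong (6 ℕ.+_) (sumFrom-const 24 0 ∣E∣)) (cong (ℕ._+ greedyCost) (cong (6 ℕ.+_) (sumFrom-const 27 0 ∣E∣)))))) (linear ∣E∣ 0<n)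

  module _ {s} (F : Final s) where
    open Final F

    stars : Clustering order
    stars = byLabel (lab ∘ S)

    stars-output : Outputs s stars
    stars-output u v = mk⇔
      (λ eq → Equivalence.to (byLabel-same (lab ∘ S) u v) (Fin.toℕ-injective (trans (sym (labels u)) (trans eq (labels v)))))
      (λ same → trans (labels u) (trans (cong toℕ (Equivalence.from (byLabel-same (lab ∘ S) u v) same)) (sym (labels v))))

    -- The payments y lie in between: they dominate the score of every clustering, and six times the
    -- score of the stars dominates them.
    totalScore≤6stars : ∀ 𝓒 → totalScore 0<deg 𝓒 ≤ fromℕ 6 * totalScore 0<deg stars
    totalScore≤6stars 𝓒 = ≤-trans
      (totalScore≤ 0<deg 𝓒 (y ∘ S) (λ w → Local.0≤y (Inv.local (proj₂ inv) w)) dual)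
      (∑y≤6score (proj₂ inv))
      where
      dual : ∀ e → e ∈ₗ edges → Priced S (proj₁ e) (proj₂ e)
      dual e e∈ = subst (λ e → Priced S (proj₁ e) (proj₂ e)) (sym (lookup-index e∈)) (priced (Any.index e∈))

  -- A clustering with positive score has a cluster, and this contains a vertex. It excludes the
  -- empty graph, where a bound linear in n + m would allow no step at all.
  0<order : ∀ 𝓒 → ¬ (totalScore 0<deg 𝓒 ≤ 0ℚ) → 0 ℕ.< order
  0<order 𝓒 = go (Clustering.k 𝓒) _ (proj₁ ∘ Clustering.nonempty 𝓒)
    where
    go : ∀ k (f : Fin k → ℚ) → (Fin k → Vertex) → ¬ (∑ (allFin k) f ≤ 0ℚ) → 0 ℕ.< order
    go zero    f v ≰0 = ⊥-elim (≰0 ≤-refl)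
    go (suc k) f v ≰0 = ℕ.≤-trans (s≤s z≤n) (Fin.toℕ<n (v Fin.zero))

  -- By `NCut≡`, k - NCut is twice the total score; the proof adds 12 - NCut to both sides of the
  -- promise.
  12≤2score : ∀ 𝓒 → NCut G 𝓒 ≤ fromℕ (Clustering.k 𝓒) - fromℕ 12 → fromℕ 12 ≤ totalScore 0<deg 𝓒 + totalScore 0<deg 𝓒
  12≤2score 𝓒 h = subst₂ _≤_
    (solve 3 (λ a t k → a :+ (t :- a) := t) refl (NCut G 𝓒) (fromℕ 12) 0ℚ)
    (trans (cong (λ k → k - fromℕ 12 + (fromℕ 12 - NCut G 𝓒)) (sym (NCut≡ 0<deg 𝓒)))
      (solve 3 (λ a e t → a :+ e :- t :+ (t :- a) := e) refl (NCut G 𝓒) (totalScore 0<deg 𝓒 + totalScore 0<deg 𝓒) (fromℕ 12)))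
    (ℚ.+-monoˡ-≤ (fromℕ 12 - NCut G 𝓒) h)

theorem2 : ∃ λ (T : ℚ) → ∃ λ (α : ℚ) → ∃ λ (P : Program) →
    0ℚ < α × α ≤ 1ℚ ×
    LinearTime P
    (λ G → Graph.NoIsolatedVertices G ×
    ∃ λ (𝓒 : Clustering (Graph.order G)) → NCut G 𝓒 ≤ fromℕ (Clustering.k 𝓒) - T)
    (λ G 𝓒 → Approximate (NMod G) α 𝓒)
theorem2 = fromℕ 12 , α , starClustering , toWitness {a? = 0ℚ ℚ.<? α} tt , toWitness {a? = α ℚ.≤? 1ℚ} tt ,
  2 , 131 , λ G (0<deg , 𝓒₀ , cut≤) →
    let open Graph G
        open GraphSums G
        12≤     = 12≤2score G 0<deg 𝓒₀ cut≤
        0<n     = 0<order G 0<deg 𝓒₀ λ ≤0 → toWitnessFalse {a? = fromℕ 12 ℚ.≤? 0ℚ} tt (≤-trans 12≤ (ℚ.+-mono-≤ ≤0 ≤0))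
        s , t , D , t≤ , F = starClustering-run G 0<deg 0<n
        𝓒 = stars G 0<deg F
    in 𝓒 , t , (s , D , stars-output G 0<deg F) , t≤ , λ 𝓒′ →
       subst₂ (λ p q → α * p ≤ q) (sym (NMod≡ 0<deg 𝓒′)) (sym (NMod≡ 0<deg 𝓒))
         -- The promised 𝓒₀ serves only to certify a large score; the competitor 𝓒′ is arbitrary.
         (approximate {e = totalScore 0<deg 𝓒} {totalScore 0<deg 𝓒′} {halfMass ∣E∣} 12≤ (totalScore≤6stars G 0<deg F 𝓒₀) (totalScore≤6stars G 0<deg F 𝓒′)
           (halfMass≤½ ∣E∣) (0≤* (0≤+ (0≤fromℕ ∣E∣) (0≤fromℕ ∣E∣)) (0≤recip (4 ℕ.* ∣E∣))) (0≤recip ∣E∣))
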